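{- Every triangulation of a connected closed $2$-dimensional surface admits a $z$-knotted shredding.
   Context: Let $M$ be a connected closed $2$-dimensional surface (not necessarily orientable). We consider connected simple finite graphs $\Gamma$ embedded in $M$ (vertices are points, edges are arcs homeomorphic to closed segments, two distinct edges are disjoint or meet in a common vertex) such that: every face (closure of a connected component of $M\setminus\Gamma$) is homeomorphic to a closed $2$-disc; every edge lies in exactly two distinct faces; and two distinct faces intersect in an edge, in a vertex, or not at all. Such a $\Gamma$ is a triangulation of $M$ if every face contains exactly three edges. Two distinct edges are adjacent if they share a vertex and lie in a common face. A zigzag is a sequence of edges $(e_i)_{i\in\mathbb N}$ such that for every $i$, $e_i,e_{i+1}$ are adjacent, and the face containing $e_i,e_{i+1}$ is distinct from the face containing $e_{i+1},e_{i+2}$; since the graph is finite the sequence is periodic and is regarded as a cyclic sequence (up to shift). The reversed sequence $Z^{ -1}$ of a zigzag $Z$ is again a zigzag. $\Gamma$ is $z$-knotted if it has exactly one pair of zigzags $\{Z,Z^{ -1}\}$. Connected sum: if $\Gamma,\Gamma'$ are triangulations of surfaces $M,M'$ with faces $F,F'$, a special homeomorphism $g:\partial F\to\partial F'$ is a homeomorphism sending vertices of $F$ to vertices of $F'$; the connected sum $\Gamma\#_g\Gamma'$ is the triangulation of $M\# M'$ obtained by removing the interiors of $F$ and $F'$ and gluing along $g$, i.e. its vertex set is the union of the vertex sets with each vertex $v$ of $F$ identified with $g(v)$, and its edge set is the union of the edge sets with each edge of $F$ identified with the corresponding edge of $F'$. A triangulation $\Gamma_2$ is a shredding of a triangulation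 $\Gamma_1$ (of the same surface) if $\Gamma_2$ can be presented as the connected sum of $\Gamma_1$ and some triangulations of the sphere $\mathbb S^2$.
   Formalization: Zigzags are also required to have e_i and e_{i+2} disjoint (the standard condition); without it the edges around each vertex form zigzags and no triangulation is z-knotted. Triangulations are combinatorial, and sphere triangulations are those of Euler characteristic 2. -}

module Defs where

open import Data.Nat using (ℕ; _*_; _<_) renaming (_+_ to _+ℕ_)
open import Data.Fin using (Fin)
open import Data.List using (List; length; lookup)
open import Data.Product using (Σ; ∃; ∃-syntax; _×_; _,_; proj₁; proj₂)
open import Data.Sum using (_⊎_)
open import Data.Integer as ℤ using (ℤ)
open import Relation.Binary.PropositionalEquality using (_≡_; _≢_)
open import Relation.Nullary using (¬_)
open import Relation.Binary.Construct.Closure.ReflexiveTransitive using (Star)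

-- Combinatorial data: vertices are Fin n, a face (triangle) is given by
-- its three vertices, an edge by its two endpoints (both unordered, i.e.
-- compared as vertex sets).

Tri : ℕ → Set
Tri n = Fin n × Fin n × Fin n

Edge : ℕ → Set
Edge n = Fin n × Fin n

module _ {n : ℕ} where

  _∈T_ : Fin n → Tri n → Set
  v ∈T (a , b , c) = v ≡ a ⊎ v ≡ b ⊎ v ≡ c

  _∈E_ : Fin n → Edge n → Set
  v ∈E (a , b) = v ≡ a ⊎ v ≡ b

  ProperTri : Tri n → Set
  ProperTri (a , b , c) = a ≢ b × b ≢ c × a ≢ c

  SameTri : Tri n → Tri n → Set
  SameTri t t' = ∀ v → (v ∈T t → v ∈T t') × (v ∈T t' → v ∈T t)

  SameEdge : Edge n → Edge n → Set
  SameEdge e e' = ∀ v → (v ∈E e → v ∈E e') × (v ∈E e' → v ∈E e)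

  EdgeIn : Edge n → Tri n → Set
  EdgeIn (a , b) t = a ∈T t × b ∈T t

  LinkStep : (fs : List (Tri n)) → Fin n → Fin (length fs) → Fin (length fs) → Set
  LinkStep fs v i j =
    ∃[ w ] (w ≢ v × EdgeIn (v , w) (lookup fs i) × EdgeIn (v , w) (lookup fs j))

  GraphAdj : (fs : List (Tri n)) → Fin n → Fin n → Set
  GraphAdj fs u w = u ≢ w × ∃[ i ] EdgeIn (u , w) (lookup fs i)

mapTri : {m n : ℕ} → (Fin m → Fin n) → Tri m → Tri n
mapTri f (a , b , c) = (f a , f b , f c)

-- A triangulation of a connected closed surface, as a combinatorial
-- closed surface: a connected simple graph with triangular faces, each
-- edge in exactly two distinct faces, the faces around each vertex
-- forming a single cycle (so that the space is a closed surface).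

record Triangulation : Set where
  field
    nV       : ℕ
    faces    : List (Tri nV)
    nonempty : 0 < length faces
    proper   : ∀ i → ProperTri (lookup faces i)
    noDup    : ∀ i j → SameTri (lookup faces i) (lookup faces j) → i ≡ j
    covers   : ∀ v → ∃[ i ] (v ∈T lookup faces i)
    edgeInTwoFaces : ∀ i (e : Edge nV) → proj₁ e ≢ proj₂ e → EdgeIn e (lookup faces i) →
      ∃[ j ] (j ≢ i × EdgeIn e (lookup faces j) ×
              (∀ k → EdgeIn e (lookup faces k) → k ≡ i ⊎ k ≡ j))
    vertexLink : ∀ v i j → v ∈T lookup faces i → v ∈T lookup faces j →
      Star (LinkStep faces v) i j
    connected : ∀ u v → Star (GraphAdj faces) u v

open Triangulation

Face : (Γ : Triangulation) → Set
Face Γ = Fin (length (faces Γ))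

face : (Γ : Triangulation) → Face Γ → Tri (nV Γ)
face Γ i = lookup (faces Γ) i

-- Zigzags.  A zigzag is a periodic sequence of edges; we index it by ℤ
-- (a periodic ℕ-sequence extends uniquely to ℤ), so that shifts and
-- reversal are easy to express.

module _ (Γ : Triangulation) where

  IsEdge : Edge (nV Γ) → Set
  IsEdge e = proj₁ e ≢ proj₂ e × ∃[ i ] EdgeIn e (face Γ i)

  Adjacent : Edge (nV Γ) → Edge (nV Γ) → Set
  Adjacent e e' = ¬ SameEdge e e' × ∃[ v ] (v ∈E e × v ∈E e') ×
                  ∃[ i ] (EdgeIn e (face Γ i) × EdgeIn e' (face Γ i))

  Disjoint : Edge (nV Γ) → Edge (nV Γ) → Set
  Disjoint e e' = ∀ v → v ∈E e → ¬ (v ∈E e')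

  IsZigzag : (ℤ → Edge (nV Γ)) → Set
  IsZigzag Z = ∀ i →
      IsEdge (Z i)
    × Adjacent (Z i) (Z (i ℤ.+ ℤ.1ℤ))
    × (∀ f f' → EdgeIn (Z i) (face Γ f) → EdgeIn (Z (i ℤ.+ ℤ.1ℤ)) (face Γ f) →
               EdgeIn (Z (i ℤ.+ ℤ.1ℤ)) (face Γ f') → EdgeIn (Z (i ℤ.+ ℤ.+ 2)) (face Γ f') →
               f ≢ f')
    × Disjoint (Z i) (Z (i ℤ.+ ℤ.+ 2))

  -- exactly one pair {Z, Z⁻¹} of zigzags, zigzags being cyclic sequences
  -- (equal up to shift)
  ZKnotted : Set
  ZKnotted = ∃[ Z ] (IsZigzag Z × (∀ Z' → IsZigzag Z' → ∃[ k ]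
      ((∀ i → SameEdge (Z' i) (Z (k ℤ.+ i)))
     ⊎ (∀ i → SameEdge (Z' i) (Z (k ℤ.- i))))))

-- Triangulations of the sphere: Euler characteristic V - E + F = 2;
-- since E = 3F/2 this reads 2V = F + 4.

IsSphereTriangulation : Triangulation → Set
IsSphereTriangulation S = 2 * nV S ≡ length (faces S) +ℕ 4

-- K is (isomorphic to) the connected sum G #_g H along faces f, f'
-- and a special homeomorphism g (a vertex bijection F → F').

record ConnectedSum (G H K : Triangulation) : Set where
  field
    f  : Face G
    f' : Face H
    α  : Fin (nV G) → Fin (nV K)
    β  : Fin (nV H) → Fin (nV K)
    α-inj : ∀ x y → α x ≡ α y → x ≡ y
    β-inj : ∀ x y → β x ≡ β y → x ≡ y
    -- the gluing map g : a ↦ a', b ↦ b', c ↦ c'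
    g-image : Tri (nV H)
    g-face  : SameTri g-image (face H f')
    glued   : α (proj₁ (face G f)) ≡ β (proj₁ g-image)
            × α (proj₁ (proj₂ (face G f))) ≡ β (proj₁ (proj₂ g-image))
            × α (proj₂ (proj₂ (face G f))) ≡ β (proj₂ (proj₂ g-image))
    onlyGlued : ∀ x y → α x ≡ β y →
        (x ≡ proj₁ (face G f) × y ≡ proj₁ g-image)
      ⊎ (x ≡ proj₁ (proj₂ (face G f)) × y ≡ proj₁ (proj₂ g-image))
      ⊎ (x ≡ proj₂ (proj₂ (face G f)) × y ≡ proj₂ (proj₂ g-image))
    vertexCover : ∀ z → (∃[ x ] α x ≡ z) ⊎ (∃[ y ] β y ≡ z)
    facesFrom : ∀ k →
        (∃[ i ] (i ≢ f × SameTri (face K k) (mapTri α (face G i))))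
      ⊎ (∃[ j ] (j ≢ f' × SameTri (face K k) (mapTri β (face H j))))
    facesG : ∀ i → i ≢ f → ∃[ k ] SameTri (face K k) (mapTri α (face G i))
    facesH : ∀ j → j ≢ f' → ∃[ k ] SameTri (face K k) (mapTri β (face H j))

data Shredding (Γ₁ : Triangulation) : Triangulation → Set where
  none : Shredding Γ₁ Γ₁
  step : ∀ {Γ₂ Γ₃} (S : Triangulation) → IsSphereTriangulation S →
         Shredding Γ₁ Γ₂ → ConnectedSum Γ₂ S Γ₃ → Shredding Γ₁ Γ₃

{-# OPTIONS --safe #-}
-- A zigzag is followed through flags, ordered triples (x, y, z) of vertices of a face standing for
-- its consecutive edges xy, yz; the next flag is (y, z, w) with w opposite to x across yz.  The
-- triangulation is z-knotted iff any two flags are equivalent under steps and reversal.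
--
-- Only tetrahedra are ever glued in, i.e. a face is subdivided by a new vertex.  Suppose some face
-- abc meets several classes of zigzags.  The pieces of zigzags outside abc match up the six
-- directed edges of abc, and since no zigzag is its own reversal none is matched with itself.  The
-- face itself joins directed edges with the same tail, so if every corner is matched with another
-- corner, then abc meets a single class after all.  Otherwise, say, ab is matched with ac.
-- Subdividing abc joins directed edges with the same head instead, which merges all classes at abc
-- unless ba is matched with ca.  In that case subdivide abc by d and then abd: the new patch joins
-- ab-bc, ba-ac and cb-ca, and again all classes at abc are merged.  In either case the number of
-- classes drops.
module Submission where

open import Defs
open import Data.Product using (Σ; ∃; ∃₂; ∃-syntax; _×_; _,_; proj₁; proj₂)
open import Data.Nat as ℕ using (ℕ; zero; suc)
import Data.Nat.Properties as ℕₚ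
open import Data.Fin as Fin using (Fin; zero; suc; toℕ)
import Data.Fin.Properties as Finₚ
open import Data.Integer as ℤ using (ℤ; +_; -[1+_])
import Data.Integer.Properties as ℤₚ
open import Data.List using (List; _∷_; length; lookup; tabulate)
open import Data.Sum as Sum using (_⊎_; inj₁; inj₂; [_,_]′; swap)
open import Data.Empty using (⊥-elim)
open import Function using (_∘_; id)
open import Relation.Nullary using (¬_; Dec; yes; no)
open import Relation.Nullary.Decidable using (_×-dec_; _⊎-dec_; _→-dec_; ¬?; from-yes)
open import Relation.Binary.PropositionalEquality
open import Relation.Binary.Construct.Closure.ReflexiveTransitive as Star using (Star; ε; _◅_; _◅◅_)
open Triangulation

-- Triangles as ordered triples of vertices

pattern fst∈ = inj₁ refl
pattern snd∈ = inj₂ (inj₁ refl)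
pattern thd∈ = inj₂ (inj₂ refl)

module _ {n : ℕ} where

  infix 4 _⊆T_

  -- For proper `s` this is already equality of vertex sets, in a form that is decided componentwise
  -- and ignores the order of the vertices.
  _⊆T_ : Tri n → Tri n → Set
  (x , y , z) ⊆T t = x ∈T t × y ∈T t × z ∈T t

  rev : Tri n → Tri n
  rev (x , y , z) = (z , y , x)

  rot : Tri n → Tri n
  rot (x , y , z) = (y , z , x)

  proper-rev : ∀ {s : Tri n} → ProperTri s → ProperTri (rev s)
  proper-rev (p , q , r) = ≢-sym q , ≢-sym p , ≢-sym r

  proper-rot : ∀ {s : Tri n} → ProperTri s → ProperTri (rot s)
  proper-rot (p , q , r) = q , ≢-sym r , ≢-sym p

  ⊆T-rev : ∀ {s t : Tri n} → s ⊆T t → rev s ⊆T t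
  ⊆T-rev (p , q , r) = r , q , p

  ⊆T-rot : ∀ {s t : Tri n} → s ⊆T t → rot s ⊆T t
  ⊆T-rot (p , q , r) = q , r , p

  ⊆T-refl : ∀ {t : Tri n} → t ⊆T t
  ⊆T-refl = inj₁ refl , snd∈ , thd∈

  _∈T?_ : ∀ (v : Fin n) (t : Tri n) → Dec (v ∈T t)
  v ∈T? (a , b , c) = (v Fin.≟ a) ⊎-dec ((v Fin.≟ b) ⊎-dec (v Fin.≟ c))

  _⊆T?_ : ∀ (s t : Tri n) → Dec (s ⊆T t)
  (x , y , z) ⊆T? t = (x ∈T? t) ×-dec ((y ∈T? t) ×-dec (z ∈T? t))

  -- Three distinct vertices among three exhaust them: the first nine clauses are the coincidences
  -- excluded by properness, the other six the permutations.
  ⊆T⇒⊇ : ∀ (s t : Tri n) → ProperTri s → s ⊆T t → ∀ {v} → v ∈T t → v ∈T s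
  ⊆T⇒⊇ _ _ (p , q , r) (fst∈ , fst∈ , _) = ⊥-elim (p refl)
  ⊆T⇒⊇ _ _ (p , q , r) (snd∈ , snd∈ , _) = ⊥-elim (p refl)
  ⊆T⇒⊇ _ _ (p , q , r) (thd∈ , thd∈ , _) = ⊥-elim (p refl)
  ⊆T⇒⊇ _ _ (p , q , r) (fst∈ , _ , fst∈) = ⊥-elim (r refl)
  ⊆T⇒⊇ _ _ (p , q , r) (snd∈ , _ , snd∈) = ⊥-elim (r refl)
  ⊆T⇒⊇ _ _ (p , q , r) (thd∈ , _ , thd∈) = ⊥-elim (r refl)
  ⊆T⇒⊇ _ _ (p , q , r) (_ , fst∈ , fst∈) = ⊥-elim (q refl)
  ⊆T⇒⊇ _ _ (p , q , r) (_ , snd∈ , snd∈) = ⊥-elim (q refl)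
  ⊆T⇒⊇ _ _ (p , q , r) (_ , thd∈ , thd∈) = ⊥-elim (q refl)
  ⊆T⇒⊇ _ _ _ (fst∈ , snd∈ , thd∈) = id
  ⊆T⇒⊇ _ _ _ (fst∈ , thd∈ , snd∈) =
    λ { (inj₁ e) → inj₁ e ; (inj₂ (inj₁ e)) → inj₂ (inj₂ e) ; (inj₂ (inj₂ e)) → inj₂ (inj₁ e) }
  ⊆T⇒⊇ _ _ _ (snd∈ , fst∈ , thd∈) =
    λ { (inj₁ e) → inj₂ (inj₁ e) ; (inj₂ (inj₁ e)) → inj₁ e ; (inj₂ (inj₂ e)) → inj₂ (inj₂ e) }
  ⊆T⇒⊇ _ _ _ (snd∈ , thd∈ , fst∈) =
    λ { (inj₁ e) → inj₂ (inj₂ e) ; (inj₂ (inj₁ e)) → inj₁ e ; (inj₂ (inj₂ e)) → inj₂ (inj₁ e) }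
  ⊆T⇒⊇ _ _ _ (thd∈ , fst∈ , snd∈) =
    λ { (inj₁ e) → inj₂ (inj₁ e) ; (inj₂ (inj₁ e)) → inj₂ (inj₂ e) ; (inj₂ (inj₂ e)) → inj₁ e }
  ⊆T⇒⊇ _ _ _ (thd∈ , snd∈ , fst∈) =
    λ { (inj₁ e) → inj₂ (inj₂ e) ; (inj₂ (inj₁ e)) → inj₂ (inj₁ e) ; (inj₂ (inj₂ e)) → inj₁ e }

  ∈T-⊆T : ∀ (s t : Tri n) → s ⊆T t → ∀ {v} → v ∈T s → v ∈T t
  ∈T-⊆T _ _ (p , q , r) fst∈ = p
  ∈T-⊆T _ _ (p , q , r) snd∈ = q
  ∈T-⊆T _ _ (p , q , r) thd∈ = r

  third : ∀ (t : Tri n) {x y} → ProperTri t → x ≢ y → x ∈T t → y ∈T t →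
          ∃[ z ] (z ∈T t × x ≢ z × y ≢ z)
  third _ _ x≢y fst∈ fst∈ = ⊥-elim (x≢y refl)
  third _ (p , q , r) _ fst∈ snd∈ = _ , thd∈ , r , q
  third _ (p , q , r) _ fst∈ thd∈ = _ , snd∈ , p , ≢-sym q
  third _ (p , q , r) _ snd∈ fst∈ = _ , thd∈ , q , r
  third _ _ x≢y snd∈ snd∈ = ⊥-elim (x≢y refl)
  third _ (p , q , r) _ snd∈ thd∈ = _ , fst∈ , ≢-sym p , ≢-sym r
  third _ (p , q , r) _ thd∈ fst∈ = _ , snd∈ , ≢-sym q , p
  third _ (p , q , r) _ thd∈ snd∈ = _ , fst∈ , ≢-sym r , ≢-sym p
  third _ _ x≢y thd∈ thd∈ = ⊥-elim (x≢y refl)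

-- Flags and the zigzag step

module _ (Γ : Triangulation) where

  -- The face `at` is determined by `s` because of `noDup`; each face carries six flags.
  record Flag (s : Tri (nV Γ)) : Set where
    constructor flag
    field
      distinct : ProperTri s
      at       : Face Γ
      inside   : s ⊆T face Γ at

  data Step : Tri (nV Γ) → Tri (nV Γ) → Set where
    step : ∀ {x y z w} → Flag (x , y , z) → Flag (y , z , w) → x ≢ w →
           Step (x , y , z) (y , z , w)

  data Gen : Tri (nV Γ) → Tri (nV Γ) → Set where
    fwd  : ∀ {s t} → Step s t → Gen s t
    bwd  : ∀ {s t} → Step t s → Gen s t
    flip : ∀ {s} → Gen s (rev s)

  Equivalent : Tri (nV Γ) → Tri (nV Γ) → Set
  Equivalent = Star Gen

module _ {Γ : Triangulation} where

  open Flag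

  flag-rev : ∀ {s} → Flag Γ s → Flag Γ (rev s)
  flag-rev (flag d i p) = flag (proper-rev d) i (⊆T-rev p)

  flag-rot : ∀ {s} → Flag Γ s → Flag Γ (rot s)
  flag-rot (flag d i p) = flag (proper-rot d) i (⊆T-rot p)

  step-rev : ∀ {s t} → Step Γ s t → Step Γ (rev t) (rev s)
  step-rev (step p q n) = step (flag-rev q) (flag-rev p) (≢-sym n)

  gen-sym : ∀ {s t} → Gen Γ s t → Gen Γ t s
  gen-sym (fwd p) = bwd p
  gen-sym (bwd p) = fwd p
  gen-sym flip = flip

  ~-sym : ∀ {s t} → Equivalent Γ s t → Equivalent Γ t s
  ~-sym = Star.reverse gen-sym

  flag-face : ∀ {s} (φ : Flag Γ s) {v} → v ∈T face Γ (at φ) → v ∈T s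
  flag-face {s} φ = ⊆T⇒⊇ s _ (distinct φ) (inside φ)

  flag-at-unique : ∀ {s} → Flag Γ s → ∀ i j → s ⊆T face Γ i → s ⊆T face Γ j → i ≡ j
  flag-at-unique {s} φ i j p q = noDup Γ i j λ v →
    ∈T-⊆T s _ q ∘ ⊆T⇒⊇ s _ (distinct φ) p , ∈T-⊆T s _ p ∘ ⊆T⇒⊇ s _ (distinct φ) q

  abstract
    -- The apex of the second face on `yz`. Were it `x`, the two faces would have the same three
    -- vertices, against `noDup`.
    opposite : ∀ {x y z} → Flag Γ (x , y , z) → ∃[ w ] (Flag Γ (y , z , w) × x ≢ w)
    opposite φ@(flag (p , q , r) i (x∈ , y∈ , z∈))
      with edgeInTwoFaces Γ i (_ , _) q (y∈ , z∈)
    ... | j , j≢i , (y∈' , z∈') , _ with third (face Γ j) (proper Γ j) q y∈' z∈'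
    ...   | w , w∈ , y≢w , z≢w =
      w , flag (q , z≢w , y≢w) j (y∈' , z∈' , w∈) ,
      λ { refl → j≢i (flag-at-unique φ j i (w∈ , y∈' , z∈') (x∈ , y∈ , z∈)) }

  distinct-faces : ∀ {x y z w} (φ : Flag Γ (x , y , z)) → Flag Γ (y , z , w) → x ≢ w →
                   ¬ (w ∈T face Γ (at φ))
  distinct-faces φ ψ x≢w m with flag-face φ m
  ... | inj₁ refl = x≢w refl
  ... | snd∈ = proj₂ (proj₂ (distinct ψ)) refl
  ... | thd∈ = proj₁ (proj₂ (distinct ψ)) refl

  -- Since `yz` lies in only two faces and neither new flag lies in that of `φ`, both lie in the
  -- other one, whose remaining vertex is determined.
  opposite-unique : ∀ {x y z w w'} → Flag Γ (x , y , z) →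
    Flag Γ (y , z , w) → x ≢ w → Flag Γ (y , z , w') → x ≢ w' → w ≡ w'
  opposite-unique {w = w} φ@(flag (p , q , r) i (x∈ , y∈ , z∈))
      ψ@(flag _ j (jy , jz , jw)) n ψ'@(flag _ j' (jy' , jz' , jw')) n'
    with edgeInTwoFaces Γ i (_ , _) q (y∈ , z∈)
  ... | k , _ , _ , only with only j (jy , jz) | only j' (jy' , jz')
  ...   | inj₁ refl | _ = ⊥-elim (distinct-faces φ ψ n jw)
  ...   | inj₂ _ | inj₁ refl = ⊥-elim (distinct-faces φ ψ' n' jw')
  ...   | inj₂ refl | inj₂ refl with flag-face ψ jw'
  ...     | inj₁ refl = ⊥-elim (proj₂ (proj₂ (distinct ψ')) refl)
  ...     | snd∈ = ⊥-elim (proj₁ (proj₂ (distinct ψ')) refl)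
  ...     | inj₂ (inj₂ e) = sym e

  step-deterministic : ∀ {s t t'} → Step Γ s t → Step Γ s t' → t ≡ t'
  step-deterministic (step φ ψ n) (step _ ψ' n') = cong (λ w → _ , _ , w) (opposite-unique φ ψ n ψ' n')

  step-codeterministic : ∀ {s s' t} → Step Γ s t → Step Γ s' t → s ≡ s'
  step-codeterministic p q = cong rev (step-deterministic (step-rev p) (step-rev q))

  -- The successor map and its periodicity

  State : Set
  State = ∃[ s ] Flag Γ s

  next : State → State
  next (_ , φ) = _ , proj₁ (proj₂ (opposite φ))

  next-step : ∀ s → Step Γ (proj₁ s) (proj₁ (next s))
  next-step (_ , φ) = step φ (proj₁ (proj₂ (opposite φ))) (proj₂ (proj₂ (opposite φ)))

  prev : State → State
  prev (_ , φ) = let s , ψ = next (_ , flag-rev φ) in rev s , flag-rev ψ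

  prev-step : ∀ s → Step Γ (proj₁ (prev s)) (proj₁ s)
  prev-step (_ , φ) = step-rev (next-step (_ , flag-rev φ))

  iterate : ℕ → State → State
  iterate zero s = s
  iterate (suc k) s = next (iterate k s)

  iterate-suc : ∀ k s → iterate k (next s) ≡ next (iterate k s)
  iterate-suc zero s = refl
  iterate-suc (suc k) s = cong next (iterate-suc k s)

  -- Steps are injective, so a common initial stretch can be cancelled; this turns a repetition
  -- somewhere on the orbit into a return to its start.
  iterate-cancel : ∀ i j s → proj₁ (iterate i s) ≡ proj₁ (iterate (i ℕ.+ j) s) →
                   proj₁ s ≡ proj₁ (iterate j s)
  iterate-cancel zero j s e = e
  iterate-cancel (suc i) j s e = iterate-cancel i j s
    (step-codeterministic (next-step (iterate i s))
      (subst (Step Γ _) (sym e) (next-step (iterate (i ℕ.+ j) s))))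

  private
    N = nV Γ

  encode : Tri N → Fin (N ℕ.* (N ℕ.* N))
  encode (x , y , z) = Fin.combine x (Fin.combine y z)

  encode-injective : ∀ (s t : Tri N) → encode s ≡ encode t → s ≡ t
  encode-injective (x , y , z) (x' , y' , z') e with Finₚ.combine-injective x _ x' _ e
  ... | refl , e' with Finₚ.combine-injective y z y' z' e'
  ...   | refl , refl = refl

  abstract
    periodic : ∀ s → ∃[ k ] proj₁ s ≡ proj₁ (iterate (suc k) s)
    periodic s with Finₚ.pigeonhole (ℕₚ.n<1+n _) (λ i → encode (proj₁ (iterate (toℕ i) s)))
    ... | i , j , i<j , e with ℕₚ.m≤n⇒∃[o]m+o≡n i<j
    -- Here `toℕ j` is `suc (toℕ i) + k`, so the period is `suc k` and never zero.
    ...   | k , p = k , iterate-cancel (toℕ i) (suc k) s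
                          (trans (encode-injective (proj₁ (iterate (toℕ i) s)) (proj₁ (iterate (toℕ j) s)) e) (cong (λ m → proj₁ (iterate m s))
                            (trans (sym p) (sym (ℕₚ.+-suc (toℕ i) k)))))

  -- A zigzag never runs back along itself: the two halves of such a run would meet in a state
  -- equal to its own reversal or to the reversal of its successor.
  no-self-reversal : ∀ k s → proj₁ (iterate k s) ≢ rev (proj₁ s)
  no-self-reversal zero (_ , φ) e = proj₂ (proj₂ (distinct φ)) (cong proj₁ e)
  no-self-reversal (suc zero) (_ , φ) e = proj₁ (proj₂ (distinct φ)) (cong proj₁ e)
  no-self-reversal (suc (suc k)) s e = no-self-reversal k (next s)
    (trans (cong proj₁ (iterate-suc k s))
      (step-codeterministic (next-step (next (iterate k s)))
        (subst (Step Γ _) (sym e) (step-rev (next-step s)))))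

-- Zigzags as orbits of flags

module _ {Γ : Triangulation} where
  open Flag

  orbit : State → ℤ → State {Γ}
  orbit s (+ k) = iterate k s
  orbit s -[1+ zero ] = prev s
  orbit s -[1+ suc k ] = prev (orbit s -[1+ k ])

  StepSequence : (ℤ → Tri (nV Γ)) → Set
  StepSequence u = ∀ i → Step Γ (u i) (u (i ℤ.+ ℤ.1ℤ))

  orbit-steps : ∀ s → StepSequence (λ i → proj₁ (orbit s i))
  orbit-steps s (+ k) rewrite ℕₚ.+-comm k 1 = next-step (iterate k s)
  orbit-steps s -[1+ zero ] = prev-step s
  orbit-steps s -[1+ suc k ] = prev-step (orbit s -[1+ k ])

  -1+1 : ∀ k → k ℤ.- ℤ.1ℤ ℤ.+ ℤ.1ℤ ≡ k
  -1+1 k = trans (ℤₚ.+-assoc k ℤ.-1ℤ ℤ.1ℤ) (ℤₚ.+-identityʳ k)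

  -- A single state fixes the whole bi-infinite sequence: determinism propagates equality forwards,
  -- codeterminism backwards.
  steps-unique : ∀ {u v} → StepSequence u → StepSequence v → u ℤ.0ℤ ≡ v ℤ.0ℤ → ∀ i → u i ≡ v i
  steps-unique {u} {v} p q e (+ zero) = e
  steps-unique {u} {v} p q e (+ suc k) = subst (λ j → u (+ j) ≡ v (+ j)) (ℕₚ.+-comm k 1)
    (step-deterministic (p (+ k)) (subst (λ t → Step Γ t _) (sym (steps-unique p q e (+ k))) (q (+ k))))
  steps-unique {u} {v} p q e -[1+ zero ] =
    step-codeterministic (p -[1+ zero ]) (subst (Step Γ _) (sym e) (q -[1+ zero ]))
  steps-unique {u} {v} p q e -[1+ suc k ] =
    step-codeterministic (p -[1+ suc k ])
      (subst (Step Γ _) (sym (steps-unique p q e -[1+ k ])) (q -[1+ suc k ]))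

  shift-steps : ∀ {u} k → StepSequence u → StepSequence (λ i → u (k ℤ.+ i))
  shift-steps {u} k p i = subst (λ j → Step Γ (u (k ℤ.+ i)) (u j)) (ℤₚ.+-assoc k i ℤ.1ℤ) (p (k ℤ.+ i))

  reverse-steps : ∀ {u} → StepSequence u → StepSequence (λ i → rev (u (ℤ.- i)))
  reverse-steps {u} p i = step-rev (subst (λ j → Step Γ (u (ℤ.- (i ℤ.+ ℤ.1ℤ))) (u j)) e (p _))
    where
    e : ℤ.- (i ℤ.+ ℤ.1ℤ) ℤ.+ ℤ.1ℤ ≡ ℤ.- i
    e = trans (cong (ℤ._+ ℤ.1ℤ) (ℤₚ.neg-distrib-+ i ℤ.1ℤ)) (-1+1 (ℤ.- i))

  OnOrbit : State → Tri (nV Γ) → Set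
  OnOrbit s t = (∃[ k ] t ≡ proj₁ (orbit s k)) ⊎ (∃[ k ] rev t ≡ proj₁ (orbit s k))

  orbit-next : ∀ s k {t} → Step Γ (proj₁ (orbit s k)) t → t ≡ proj₁ (orbit s (k ℤ.+ ℤ.1ℤ))
  orbit-next s k p = step-deterministic p (orbit-steps s k)

  orbit-prev : ∀ s k {t} → Step Γ t (proj₁ (orbit s k)) → t ≡ proj₁ (orbit s (k ℤ.- ℤ.1ℤ))
  orbit-prev s k p = step-codeterministic p
    (subst (λ j → Step Γ (proj₁ (orbit s (k ℤ.- ℤ.1ℤ))) (proj₁ (orbit s j))) (-1+1 k) (orbit-steps s (k ℤ.- ℤ.1ℤ)))

  -- An orbit together with its reversal is closed under all generators, since reversal exchanges
  -- forward and backward steps.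
  onOrbit-gen : ∀ {s t t'} → Gen Γ t t' → OnOrbit s t → OnOrbit s t'
  onOrbit-gen {s} (fwd p) (inj₁ (k , refl)) = inj₁ (k ℤ.+ ℤ.1ℤ , orbit-next s k p)
  onOrbit-gen {s} {t} {t'} (fwd p) (inj₂ (k , e)) =
    inj₂ (k ℤ.- ℤ.1ℤ , orbit-prev s k (subst (Step Γ (rev t')) e (step-rev p)))
  onOrbit-gen {s} (bwd p) (inj₁ (k , refl)) = inj₁ (k ℤ.- ℤ.1ℤ , orbit-prev s k p)
  onOrbit-gen {s} {t} {t'} (bwd p) (inj₂ (k , e)) =
    inj₂ (k ℤ.+ ℤ.1ℤ , orbit-next s k (subst (λ r → Step Γ r (rev t')) e (step-rev p)))
  onOrbit-gen flip (inj₁ p) = inj₂ p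
  onOrbit-gen flip (inj₂ p) = inj₁ p

  ~⇒onOrbit : ∀ {s t} → Equivalent Γ (proj₁ s) t → OnOrbit s t
  ~⇒onOrbit {s} p = go p (inj₁ (+ 0 , refl))
    where
    go : ∀ {t t'} → Equivalent Γ t t' → OnOrbit s t → OnOrbit s t'
    go ε q = q
    go (g ◅ p) q = go p (onOrbit-gen g q)

  firstEdge : Tri (nV Γ) → Edge (nV Γ)
  firstEdge (x , y , z) = x , y

  private
    V = Fin (nV Γ)

  -- The condition `x ≢ w` of the first step gives the change of face and, with properness of the
  -- flags, the disjointness of the first and third edges.
  two-steps⇒zigzag : ∀ {s t r} → Step Γ s t → Step Γ t r →
      IsEdge Γ (firstEdge s)
    × Adjacent Γ (firstEdge s) (firstEdge t)
    × (∀ f f' → EdgeIn (firstEdge s) (face Γ f) → EdgeIn (firstEdge t) (face Γ f) →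
               EdgeIn (firstEdge t) (face Γ f') → EdgeIn (firstEdge r) (face Γ f') → f ≢ f')
    × Disjoint Γ (firstEdge s) (firstEdge r)
  two-steps⇒zigzag {x , y , z} {_ , _ , w} (step φ@(flag (x≢y , y≢z , x≢z) i (x∈ , y∈ , z∈)) ψ x≢w) (step _ χ y≢v) =
    (x≢y , i , x∈ , y∈) ,
    ((λ same → [ x≢y , x≢z ]′ (proj₁ (same x) (inj₁ refl))) ,
     y , (inj₂ refl , inj₁ refl) , i , (x∈ , y∈) , (y∈ , z∈)) ,
    (λ { f .f (p , q) (_ , r) _ (_ , w∈) refl →
         distinct-faces (flag (x≢y , y≢z , x≢z) f (p , q , r)) ψ x≢w w∈ }) ,
    λ { v (inj₁ refl) (inj₁ refl) → x≢z refl
      ; v (inj₁ refl) (inj₂ refl) → x≢w refl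
      ; v (inj₂ refl) (inj₁ refl) → y≢z refl
      ; v (inj₂ refl) (inj₂ refl) → proj₂ (proj₂ (distinct ψ)) refl }

  steps⇒zigzag : ∀ {u} → StepSequence u → IsZigzag Γ (firstEdge ∘ u)
  steps⇒zigzag {u} p i = two-steps⇒zigzag (p i)
    (subst (λ j → Step Γ (u (i ℤ.+ ℤ.1ℤ)) (u j)) (ℤₚ.+-assoc i ℤ.1ℤ ℤ.1ℤ) (p (i ℤ.+ ℤ.1ℤ)))

  -- From zigzags back to sequences of flags

  Ends : Edge (nV Γ) → V → V → Set
  Ends e x y = e ≡ (x , y) ⊎ e ≡ (y , x)

  ends⇒same : ∀ {e e' x y} → Ends e x y → Ends e' x y → SameEdge e e'
  ends⇒same (inj₁ refl) (inj₁ refl) v = id , id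
  ends⇒same (inj₁ refl) (inj₂ refl) v = swap , swap
  ends⇒same (inj₂ refl) (inj₁ refl) v = swap , swap
  ends⇒same (inj₂ refl) (inj₂ refl) v = id , id

  ends : ∀ {e v} → v ∈E e → ∃[ x ] Ends e x v
  ends (inj₁ refl) = _ , inj₂ refl
  ends (inj₂ refl) = _ , inj₁ refl

  ends-∈ˡ : ∀ {e x v} → Ends e x v → x ∈E e
  ends-∈ˡ (inj₁ refl) = inj₁ refl
  ends-∈ˡ (inj₂ refl) = inj₂ refl

  ends-∈ʳ : ∀ {e x v} → Ends e x v → v ∈E e
  ends-∈ʳ (inj₁ refl) = inj₂ refl
  ends-∈ʳ (inj₂ refl) = inj₁ refl

  ends-distinct : ∀ {e x v} → Ends e x v → proj₁ e ≢ proj₂ e → x ≢ v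
  ends-distinct (inj₁ refl) n = n
  ends-distinct (inj₂ refl) n = ≢-sym n

  ends-other : ∀ {e x v x' v'} → Ends e x v → Ends e x' v' → v' ≢ x → x ≡ x' × v ≡ v'
  ends-other (inj₁ refl) (inj₁ refl) n = refl , refl
  ends-other (inj₁ refl) (inj₂ refl) n = ⊥-elim (n refl)
  ends-other (inj₂ refl) (inj₁ refl) n = ⊥-elim (n refl)
  ends-other (inj₂ refl) (inj₂ refl) n = refl , refl

  ends-in : ∀ {e x v} f → Ends e x v → EdgeIn e (face Γ f) → x ∈T face Γ f × v ∈T face Γ f
  ends-in f (inj₁ refl) p = p
  ends-in f (inj₂ refl) (p , q) = q , p

  -- The common vertex is the middle of the flag; if the two far ends agreed, the edges would be the
  -- same.
  adjacent⇒flag : ∀ {e e'} → proj₁ e ≢ proj₂ e → proj₁ e' ≢ proj₂ e' → Adjacent Γ e e' →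
    ∃[ x ] ∃[ v ] ∃[ z ] (Flag Γ (x , v , z) × Ends e x v × Ends e' z v)
  adjacent⇒flag n n' (ns , v , (m , m') , f , i , i') with ends m | ends m'
  ... | x , E | z , E' = x , v , z ,
    flag (ends-distinct E n , ≢-sym (ends-distinct E' n') , λ { refl → ns (ends⇒same E E') }) f
      (proj₁ (ends-in f E i) , proj₂ (ends-in f E i) , proj₁ (ends-in f E' i')) , E , E'

  -- The two middle vertices differ, since a common one would lie on both `e` and `e''`, which are
  -- disjoint. Hence `e'` runs from the first middle vertex to the second.
  consecutive-flags : ∀ {e e' e'' x v z x' v' z'} →
    Flag Γ (x , v , z) → Ends e x v → Ends e' z v →
    Flag Γ (x' , v' , z') → Ends e' x' v' → Ends e'' z' v' →
    Disjoint Γ e e'' → Step Γ (x , v , z) (x' , v' , z')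
  consecutive-flags φ E E' φ' G G' dis
    with ends-other (swap E') G (λ { refl → dis _ (ends-∈ʳ E) (ends-∈ʳ G') })
  ... | refl , refl = step φ φ' λ { refl → dis _ (ends-∈ˡ E) (ends-∈ˡ G') }

  module _ {Z : ℤ → Edge (nV Γ)} (zz : IsZigzag Γ Z) where

    flagAt : ∀ i → ∃[ x ] ∃[ v ] ∃[ z ] (Flag Γ (x , v , z) × Ends (Z i) x v × Ends (Z (i ℤ.+ ℤ.1ℤ)) z v)
    flagAt i = adjacent⇒flag (proj₁ (proj₁ (zz i))) (proj₁ (proj₁ (zz (i ℤ.+ ℤ.1ℤ)))) (proj₁ (proj₂ (zz i)))

    states : ℤ → Tri (nV Γ)
    states i = let x , v , z , _ = flagAt i in x , v , z

    states-ends : ∀ i → Ends (Z i) (proj₁ (states i)) (proj₁ (proj₂ (states i)))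
    states-ends i = let _ , _ , _ , _ , E , _ = flagAt i in E

    zigzag⇒steps : StepSequence states
    zigzag⇒steps i =
      let _ , _ , _ , φ , E , E' = flagAt i
          _ , _ , _ , φ' , G , G' = flagAt (i ℤ.+ ℤ.1ℤ)
      in consecutive-flags φ E E' φ' G G'
           (subst (λ j → Disjoint Γ (Z i) (Z j)) (sym (ℤₚ.+-assoc i ℤ.1ℤ ℤ.1ℤ)) (proj₂ (proj₂ (proj₂ (zz i)))))

  -- A zigzag comes from a sequence of flags whose initial flag lies on the orbit of `s` or on its
  -- reversal; uniqueness of step sequences then identifies all of it.
  all-equivalent⇒zKnotted : (s : State) → (∀ t → Flag Γ t → Equivalent Γ (proj₁ s) t) → ZKnotted Γ
  all-equivalent⇒zKnotted s all = firstEdge ∘ w , steps⇒zigzag (orbit-steps s) , unique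
    where
    w : ℤ → Tri (nV Γ)
    w = proj₁ ∘ orbit s

    unique : ∀ Z' → IsZigzag Γ Z' → ∃[ k ]
      ((∀ i → SameEdge (Z' i) (firstEdge (w (k ℤ.+ i)))) ⊎ (∀ i → SameEdge (Z' i) (firstEdge (w (k ℤ.- i)))))
    unique Z' zz with ~⇒onOrbit (all (states zz ℤ.0ℤ) (proj₁ (proj₂ (proj₂ (proj₂ (flagAt zz ℤ.0ℤ))))))
    ... | inj₁ (k , e) = k , inj₁ λ i → ends⇒same (states-ends zz i)
            (inj₁ (cong firstEdge (sym (steps-unique (zigzag⇒steps zz) (shift-steps k (orbit-steps s))
              (trans e (cong w (sym (ℤₚ.+-identityʳ k)))) i))))
    -- The edge `Z' i` is the last edge of the orbit's flag at `k - i`, hence the first edge of the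
    -- flag after it; this is the extra one in the shift.
    ... | inj₂ (k , e) = k ℤ.+ ℤ.1ℤ , inj₂ λ i → ends⇒same (states-ends zz i) (inj₂ (reversed i))
      where
      same : ∀ i → rev (states zz i) ≡ w (k ℤ.- i)
      same i = trans (cong (rev ∘ states zz) (sym (ℤₚ.neg-involutive i)))
        (steps-unique (reverse-steps (zigzag⇒steps zz)) (shift-steps k (orbit-steps s))
              (trans e (cong w (sym (ℤₚ.+-identityʳ k)))) (ℤ.- i))

      firstEdge-next : ∀ {s t} → Step Γ (rev s) t → firstEdge t ≡ (proj₁ (proj₂ s) , proj₁ s)
      firstEdge-next (step _ _ _) = refl

      arith : ∀ i → k ℤ.- i ℤ.+ ℤ.1ℤ ≡ k ℤ.+ ℤ.1ℤ ℤ.- i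
      arith i = trans (ℤₚ.+-assoc k (ℤ.- i) ℤ.1ℤ)
        (trans (cong (λ j → k ℤ.+ j) (ℤₚ.+-comm (ℤ.- i) ℤ.1ℤ)) (sym (ℤₚ.+-assoc k ℤ.1ℤ (ℤ.- i))))

      reversed : ∀ i → firstEdge (w (k ℤ.+ ℤ.1ℤ ℤ.- i)) ≡ (proj₁ (proj₂ (states zz i)) , proj₁ (states zz i))
      reversed i = trans (cong (firstEdge ∘ w) (sym (arith i)))
        (firstEdge-next {states zz i} (subst (λ t → Step Γ t (w (k ℤ.- i ℤ.+ ℤ.1ℤ))) (sym (same i)) (orbit-steps s (k ℤ.- i))))

-- Connectedness through faces

module _ {Γ : Triangulation} where
  open Flag

  FaceEquivalent : Face Γ → Face Γ → Set
  FaceEquivalent i j = ∀ s t → ProperTri s → s ⊆T face Γ i → ProperTri t → t ⊆T face Γ j → Equivalent Γ s t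

  face-trans : ∀ {i j k} → FaceEquivalent i j → FaceEquivalent j k → FaceEquivalent i k
  face-trans {j = j} p q s t ps s⊆ pt t⊆ =
    p s (face Γ j) ps s⊆ (proper Γ j) ⊆T-refl ◅◅ q (face Γ j) t (proper Γ j) ⊆T-refl pt t⊆

  module _ (uniform : ∀ i → FaceEquivalent i i) where

    -- Equal third vertices mean equal faces; otherwise a zigzag steps across `vw` from one face to
    -- the other.
    share-edge⇒equivalent : ∀ {i j v w} → v ≢ w → EdgeIn (v , w) (face Γ i) → EdgeIn (v , w) (face Γ j) →
                            FaceEquivalent i j
    share-edge⇒equivalent {i} {j} {v} {w} v≢w (v∈i , w∈i) (v∈j , w∈j)
      with third (face Γ i) (proper Γ i) v≢w v∈i w∈i | third (face Γ j) (proper Γ j) v≢w v∈j w∈j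
    ... | x , x∈ , v≢x , w≢x | y , y∈ , v≢y , w≢y with x Fin.≟ y
    ...   | yes refl = subst (FaceEquivalent i)
              (flag-at-unique {Γ} (flag (v≢w , w≢x , v≢x) i (v∈i , w∈i , x∈)) i j (v∈i , w∈i , x∈) (v∈j , w∈j , y∈))
              (uniform i)
    ...   | no x≢y = λ s t ps s⊆ pt t⊆ →
              uniform i s (x , v , w) ps s⊆ (≢-sym v≢x , v≢w , ≢-sym w≢x) (x∈ , v∈i , w∈i) ◅◅
              fwd (step (flag (≢-sym v≢x , v≢w , ≢-sym w≢x) i (x∈ , v∈i , w∈i))
                        (flag (v≢w , w≢y , v≢y) j (v∈j , w∈j , y∈)) x≢y) ◅
              uniform j (v , w , y) t (v≢w , w≢y , v≢y) (v∈j , w∈j , y∈) pt t⊆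

    link⇒equivalent : ∀ {v i j} → Star (LinkStep (faces Γ) v) i j → FaceEquivalent i j
    link⇒equivalent ε = uniform _
    link⇒equivalent {i = i} {j} (_◅_ {j = k} (w , w≢v , p , q) ls) =
      face-trans {i} {k} {j} (share-edge⇒equivalent (≢-sym w≢v) p q) (link⇒equivalent ls)

    -- Faces around a vertex are linked through edges, and each edge of the path supplies a face
    -- containing both of its ends.
    path⇒equivalent : ∀ {u v i j} → Star (GraphAdj (faces Γ)) u v →
                      u ∈T face Γ i → v ∈T face Γ j → FaceEquivalent i j
    path⇒equivalent {u} {i = i} {j} ε p q = link⇒equivalent (vertexLink Γ u i j p q)
    path⇒equivalent {u} {i = i} {j} ((_ , k , u∈k , w∈k) ◅ as) p q =
      face-trans {i} {k} {j} (link⇒equivalent (vertexLink Γ u i k p u∈k)) (path⇒equivalent as w∈k q)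

    uniform⇒all-equivalent : ∀ {s t} → Flag Γ s → Flag Γ t → Equivalent Γ s t
    uniform⇒all-equivalent {s} {t} (flag ps i s⊆@(x∈ , _)) (flag pt j t⊆@(y∈ , _)) =
      path⇒equivalent (connected Γ _ _) x∈ y∈ s t ps s⊆ pt t⊆

-- Pieces of zigzags outside a face

module _ (Γ : Triangulation) (f : Face Γ) where
  open Flag

  Outer : Tri (nV Γ) → Set
  Outer s = ¬ (s ⊆T face Γ f)

  record OuterStep (s t : Tri (nV Γ)) : Set where
    constructor outerStep
    field
      isStep  : Step Γ s t
      source  : Outer s
      target  : Outer t

  -- A zigzag leaving f across xy continues with the flag (x, y, w), w being the outer apex over xy.
  record Port (x y w : Fin (nV Γ)) : Set where
    constructor port
    field
      port-flag  : Flag Γ (x , y , w)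
      port-outer : Outer (x , y , w)

  -- A zigzag that leaves f across xy next enters f along y'x', so its reversal leaves across x'y'.
  Linked : (x y x' y' : Fin (nV Γ)) → Set
  Linked x y x' y' = ∀ {w w'} → Port x y w → Port x' y' w' → Star OuterStep (x , y , w) (w' , y' , x')

  -- The six orderings of the vertices of `f` serve as its six directed edges `xy`, each with its
  -- opposite vertex `z`.
  record Corner (x y z : Fin (nV Γ)) : Set where
    constructor corner
    field
      corner-proper : ProperTri (x , y , z)
      corner-inside : (x , y , z) ⊆T face Γ f

module _ {Γ : Triangulation} {f : Face Γ} where
  open Flag

  corner-flag : ∀ {x y z} → Corner Γ f x y z → Flag Γ (x , y , z)
  corner-flag (corner p q) = flag p f q

  corner-rot : ∀ {x y z} → Corner Γ f x y z → Corner Γ f y z x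
  corner-rot (corner p q) = corner (proper-rot p) (⊆T-rot q)

  corner-rev : ∀ {x y z} → Corner Γ f x y z → Corner Γ f z y x
  corner-rev (corner p q) = corner (proper-rev p) (⊆T-rev q)

  corner-swap : ∀ {x y z} → Corner Γ f x y z → Corner Γ f y x z
  corner-swap c = corner-rot (corner-rev c)

  corner-∈ : ∀ {x y z v} → Corner Γ f x y z → v ∈T face Γ f → v ≡ x ⊎ v ≡ y ⊎ v ≡ z
  corner-∈ (corner p q) = ⊆T⇒⊇ _ _ p q

  port-exists : ∀ {x y z} → Corner Γ f x y z → ∃[ w ] Port Γ f x y w
  port-exists c = let φ = corner-flag (corner-rot (corner-rot c))
                      w , ψ , z≢w = opposite φ
                  in w , port ψ λ { (_ , _ , w∈) → distinct-faces φ ψ z≢w w∈ }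

  port-apex : ∀ {x y z w} → Corner Γ f x y z → Port Γ f x y w → z ≢ w
  port-apex (corner _ (x∈ , y∈ , z∈)) (port _ o) refl = o (x∈ , y∈ , z∈)

  port-unique : ∀ {x y z w w'} → Corner Γ f x y z → Port Γ f x y w → Port Γ f x y w' → w ≡ w'
  port-unique c p@(port φ _) p'@(port φ' _) =
    opposite-unique (corner-flag (corner-rot (corner-rot c))) φ (port-apex c p) φ' (port-apex c p')

  -- The recursion stops just before the first return to `f`, so every flag up to index `m` is
  -- outer.
  outer-run : ∀ k (s : State {Γ}) → Outer Γ f (proj₁ s) → proj₁ (iterate k s) ⊆T face Γ f →
    ∃[ m ] (Star (OuterStep Γ f) (proj₁ s) (proj₁ (iterate m s)) ×
            Outer Γ f (proj₁ (iterate m s)) × proj₁ (iterate (suc m) s) ⊆T face Γ f)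
  outer-run zero s o i = ⊥-elim (o i)
  outer-run (suc k) s o i with proj₁ (next s) ⊆T? face Γ f
  ... | yes p = 0 , ε , o , p
  ... | no o' with outer-run k (next s) o' (subst (λ t → proj₁ t ⊆T face Γ f) (sym (iterate-suc k s)) i)
  ...   | m , r , o'' , q rewrite iterate-suc m s = suc m , outerStep (next-step s) o o' ◅ r , o'' , q

  LinkedToOther : (x y : Fin (nV Γ)) → Set
  LinkedToOther x y =
    ∃[ x' ] ∃[ y' ] (x' ∈T face Γ f × y' ∈T face Γ f × x' ≢ y' × ¬ (x' ≡ x × y' ≡ y) × Linked Γ f x y x' y')

  -- The last outer flag, reversed, is a port over `x'y'`. If `x'y'` were `xy`, this would be the
  -- initial port, and the run would carry a flag to its own reversal.
  close-run : ∀ {x y z w u u'} m (c : Corner Γ f x y z) (P : Port Γ f x y w) →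
    u ≡ proj₁ (iterate m (_ , Port.port-flag P)) → Star (OuterStep Γ f) (x , y , w) u →
    Outer Γ f u → Step Γ u u' → u' ⊆T face Γ f → LinkedToOther x y
  close-run {x} {y} {u = w' , y' , x'} m c P eq r o (step φ ψ _) (y'∈ , x'∈ , v∈) =
    x' , y' , x'∈ , y'∈ , ≢-sym (proj₁ (distinct ψ)) ,
    (λ { (refl , refl) → no-self-reversal m _ (trans (sym eq)
           (cong (λ w → w , y' , x') (port-unique c Q P))) }) ,
    -- The apex over an edge is unique, so the run found for particular ports serves for all.
    λ R R' → subst₂ (λ w w' → Star (OuterStep Γ f) (x , y , w) (w' , y' , x'))
      (port-unique c P R) (port-unique c' Q R') r
    where
    Q : Port Γ f x' y' w'
    Q = port (flag-rev φ) (λ i → o (⊆T-rev i))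
    c' : Corner Γ f x' y' _
    c' = corner-swap (corner (distinct ψ) (y'∈ , x'∈ , v∈))

  abstract
    -- The orbit of the inner flag `(z, x, y)` is periodic, so after leaving across `xy` it must
    -- come back into `f`.
    linked-to-other : ∀ {x y z} → Corner Γ f x y z → LinkedToOther x y
    linked-to-other {x} {y} {z} c =
      let k , e = periodic s₀
          m , r , o , q = outer-run k (next s₀) (Port.port-outer P) (returns k e)
      in close-run m c P refl r o (next-step (iterate m (next s₀))) q
      where
      s₀ : State {Γ}
      s₀ = _ , corner-flag (corner-rot (corner-rot c))

      P : Port Γ f x y (proj₁ (port-exists c))
      P = proj₂ (port-exists c)

      returns : ∀ k → proj₁ s₀ ≡ proj₁ (iterate (suc k) s₀) → proj₁ (iterate k (next s₀)) ⊆T face Γ f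
      returns k e = subst (_⊆T face Γ f) (trans e (cong proj₁ (sym (iterate-suc k s₀))))
        (⊆T-rot (⊆T-rot (Corner.corner-inside c)))

  data Linking (x y z : Fin (nV Γ)) : Set where
    to-xz : Linked Γ f x y x z → Linking x y z
    to-yx : Linked Γ f x y y x → Linking x y z
    to-yz : Linked Γ f x y y z → Linking x y z
    to-zx : Linked Γ f x y z x → Linking x y z
    to-zy : Linked Γ f x y z y → Linking x y z

  linking : ∀ {x y z} → Corner Γ f x y z → Linking x y z
  linking c with linked-to-other c
  ... | x' , y' , x'∈ , y'∈ , x'≢y' , new , l with corner-∈ c x'∈ | corner-∈ c y'∈
  ... | inj₁ refl | inj₁ refl = ⊥-elim (x'≢y' refl)
  ... | inj₁ refl | snd∈ = ⊥-elim (new (refl , refl))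
  ... | inj₁ refl | thd∈ = to-xz l
  ... | snd∈ | inj₁ refl = to-yx l
  ... | snd∈ | snd∈ = ⊥-elim (x'≢y' refl)
  ... | snd∈ | thd∈ = to-yz l
  ... | thd∈ | inj₁ refl = to-zx l
  ... | thd∈ | snd∈ = to-zy l
  ... | thd∈ | thd∈ = ⊥-elim (x'≢y' refl)

-- Triangulations from families of triangles

module _ {n N : ℕ} (tri : Fin N → Tri n) where

  -- Faces are indexed by `Fin N` instead of by list positions, so that they can be given by cases;
  -- `edgeTwo` names the two faces at an edge symmetrically.
  record IsSurface : Set where
    field
      proper'   : ∀ i → ProperTri (tri i)
      noDup'    : ∀ i j → SameTri (tri i) (tri j) → i ≡ j
      covers'   : ∀ v → ∃[ i ] (v ∈T tri i)
      edgeTwo   : ∀ (e : Edge n) → proj₁ e ≢ proj₂ e → ∀ i → EdgeIn e (tri i) →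
        ∃[ j ] ∃[ k ] (j ≢ k × EdgeIn e (tri j) × EdgeIn e (tri k) × (∀ l → EdgeIn e (tri l) → l ≡ j ⊎ l ≡ k))
      link      : ∀ v i j → v ∈T tri i → v ∈T tri j →
        Star (λ i j → ∃[ w ] (w ≢ v × EdgeIn (v , w) (tri i) × EdgeIn (v , w) (tri j))) i j
      connected' : ∀ u v → Star (λ u w → u ≢ w × ∃[ i ] EdgeIn (u , w) (tri i)) u v

position : ∀ {A : Set} {N} (t : Fin N → A) → Fin (length (tabulate t)) → Fin N
position {N = suc N} t zero = zero
position {N = suc N} t (suc k) = suc (position (t ∘ suc) k)

lookup-position : ∀ {A : Set} {N} (t : Fin N → A) k → lookup (tabulate t) k ≡ t (position t k)
lookup-position {N = suc N} t zero = refl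
lookup-position {N = suc N} t (suc k) = lookup-position (t ∘ suc) k

index : ∀ {A : Set} {N} (t : Fin N → A) → Fin N → Fin (length (tabulate t))
index t zero = zero
index t (suc i) = suc (index (t ∘ suc) i)

position-index : ∀ {A : Set} {N} (t : Fin N → A) i → position t (index t i) ≡ i
position-index t zero = refl
position-index t (suc i) = cong suc (position-index (t ∘ suc) i)

index-position : ∀ {A : Set} {N} (t : Fin N → A) k → index t (position t k) ≡ k
index-position {N = suc N} t zero = refl
index-position {N = suc N} t (suc k) = cong suc (index-position (t ∘ suc) k)

lookup-index : ∀ {A : Set} {N} (t : Fin N → A) i → lookup (tabulate t) (index t i) ≡ t i
lookup-index t i = trans (lookup-position t (index t i)) (cong t (position-index t i))

module _ {n N : ℕ} (tri : Fin N → Tri n) (i₀ : Fin N) (S : IsSurface tri) where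
  open IsSurface S

  private
    fs = tabulate tri

    to : ∀ {P : Tri n → Set} i → P (tri i) → P (lookup fs (index tri i))
    to {P} i = subst P (sym (lookup-index tri i))

    from : ∀ {P : Tri n → Set} k → P (lookup fs k) → P (tri (position tri k))
    from {P} k = subst P (lookup-position tri k)

    position-injective : ∀ {k l} → position tri k ≡ position tri l → k ≡ l
    position-injective {k} {l} e =
      trans (sym (index-position tri k)) (trans (cong (index tri) e) (index-position tri l))

    to-position : ∀ {k i} → position tri k ≡ i → k ≡ index tri i
    to-position {k} e = trans (sym (index-position tri k)) (cong (index tri) e)

    0<length : ∀ {A : Set} (xs : List A) → Fin (length xs) → 0 ℕ.< length xs
    0<length (_ ∷ _) _ = ℕ.z<s

    inTwo : ∀ k (e : Edge n) → proj₁ e ≢ proj₂ e → EdgeIn e (lookup fs k) →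
      ∃[ l ] (l ≢ k × EdgeIn e (lookup fs l) × (∀ m → EdgeIn e (lookup fs m) → m ≡ k ⊎ m ≡ l))
    inTwo k e n p with edgeTwo e n (position tri k) (from {EdgeIn e} k p)
    ... | i , j , i≢j , pi , pj , only with only (position tri k) (from {EdgeIn e} k p)
    ...   | inj₁ refl = index tri j ,
            (λ { refl → i≢j (position-index tri j) }) , to {EdgeIn e} j pj ,
            λ m q → Sum.map position-injective to-position (only (position tri m) (from {EdgeIn e} m q))
    ...   | inj₂ refl = index tri i ,
            (λ { refl → i≢j (sym (position-index tri i)) }) , to {EdgeIn e} i pi ,
            λ m q → swap (Sum.map to-position position-injective (only (position tri m) (from {EdgeIn e} m q)))

  triangulation : Triangulation
  triangulation = record
    { nV = n
    ; faces = fs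
    ; nonempty = 0<length fs (index tri i₀)
    ; proper = λ k → subst ProperTri (sym (lookup-position tri k)) (proper' (position tri k))
    ; noDup = λ k l same → position-injective
        (noDup' _ _ (subst₂ SameTri (lookup-position tri k) (lookup-position tri l) same))
    ; covers = λ v → let i , p = covers' v in index tri i , to {v ∈T_} i p
    ; edgeInTwoFaces = inTwo
    ; vertexLink = λ v k l p q →
        subst₂ (Star (LinkStep fs v)) (index-position tri k) (index-position tri l)
          (Star.gmap (index tri)
            (λ { {i} {j} (w , w≢v , pi , pj) → w , w≢v , to {EdgeIn (v , w)} i pi , to {EdgeIn (v , w)} j pj })
            (link v _ _ (from {v ∈T_} k p) (from {v ∈T_} l q)))
    ; connected = λ u v → Star.map
        (λ { {u} {w} (u≢w , i , p) → u≢w , index tri i , to {EdgeIn (u , w)} i p }) (connected' u v)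
    }

-- The tetrahedron

∈E? : ∀ {n} (e : Edge n) (t : Tri n) → Dec (EdgeIn e t)
∈E? (x , y) t = (x ∈T? t) ×-dec (y ∈T? t)

-- The three faces at vertex `zero` come first, in the order of the cone triangles used below; the
-- last face, opposite to `zero`, is the one glued.
tetra : Fin 4 → Tri 4
tetra zero = zero , suc (suc zero) , suc (suc (suc zero))
tetra (suc zero) = zero , suc zero , suc (suc (suc zero))
tetra (suc (suc zero)) = zero , suc zero , suc (suc zero)
tetra (suc (suc (suc zero))) = suc zero , suc (suc zero) , suc (suc (suc zero))

private
  _≢?_ : ∀ {n} (i j : Fin n) → Dec (i ≢ j)
  i ≢? j = ¬? (i Fin.≟ j)

  all? : ∀ {n} {P : Fin n → Set} → (∀ i → Dec (P i)) → Dec (∀ i → P i)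
  all? = Finₚ.all?

  any? : ∀ {n} {P : Fin n → Set} → (∀ i → Dec (P i)) → Dec (∃ P)
  any? = Finₚ.any?

tetra-surface : IsSurface tetra
tetra-surface = record
  { proper' = from-yes (all? λ i → proper? (tetra i))
  ; noDup' = from-yes (all? λ i → all? λ j → all? (λ v →
      ((v ∈T? tetra i) →-dec (v ∈T? tetra j)) ×-dec ((v ∈T? tetra j) →-dec (v ∈T? tetra i))) →-dec (i Fin.≟ j))
  ; covers' = from-yes (all? λ v → any? λ i → v ∈T? tetra i)
  ; edgeTwo = λ { (x , y) x≢y _ _ → edge x y x≢y }
  -- Any two faces at a vertex share an edge through it, so one link step suffices.
  ; link = λ v i j p q → step-link v i j p q ◅ ε
  ; connected' = conn
  }
  where
  proper? : ∀ {n} (t : Tri n) → Dec (ProperTri t)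
  proper? (x , y , z) = (x ≢? y) ×-dec ((y ≢? z) ×-dec (x ≢? z))

  edge : ∀ x y → x ≢ y → ∃[ j ] ∃[ k ] (j ≢ k × EdgeIn (x , y) (tetra j) × EdgeIn (x , y) (tetra k) ×
           (∀ l → EdgeIn (x , y) (tetra l) → l ≡ j ⊎ l ≡ k))
  edge = from-yes (all? λ x → all? λ y → (x ≢? y) →-dec any? λ j → any? λ k →
    (j ≢? k) ×-dec (∈E? (x , y) (tetra j) ×-dec (∈E? (x , y) (tetra k) ×-dec
      all? λ l → ∈E? (x , y) (tetra l) →-dec ((l Fin.≟ j) ⊎-dec (l Fin.≟ k)))))

  step-link : ∀ v i j → v ∈T tetra i → v ∈T tetra j →
    ∃[ w ] (w ≢ v × EdgeIn (v , w) (tetra i) × EdgeIn (v , w) (tetra j))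
  step-link = from-yes (all? λ v → all? λ i → all? λ j → (v ∈T? tetra i) →-dec ((v ∈T? tetra j) →-dec
    any? λ w → (w ≢? v) ×-dec (∈E? (v , w) (tetra i) ×-dec ∈E? (v , w) (tetra j))))

  adjacent : ∀ u v → u ≢ v → ∃[ i ] EdgeIn (u , v) (tetra i)
  adjacent = from-yes (all? λ u → all? λ v → (u ≢? v) →-dec any? λ i → ∈E? (u , v) (tetra i))

  conn : ∀ u v → Star (λ u w → u ≢ w × ∃[ i ] EdgeIn (u , w) (tetra i)) u v
  conn u v with u Fin.≟ v
  ... | yes refl = ε
  ... | no u≢v = (u≢v , adjacent u v u≢v) ◅ ε

tetrahedron : Triangulation
tetrahedron = triangulation tetra zero tetra-surface

tetrahedron-sphere : IsSphereTriangulation tetrahedron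
tetrahedron-sphere = refl

-- Subdividing a face by a new vertex

data Origin (Γ : Triangulation) (f : Face Γ) {n' : ℕ} (lift : Fin (nV Γ) → Fin n') (apex : Fin n') :
            Tri n' → Set where
  old : ∀ s → Flag Γ s → Outer Γ f s → Origin Γ f lift apex (mapTri lift s)
  new₁ : ∀ {x y} → x ∈T face Γ f → y ∈T face Γ f → x ≢ y → Origin Γ f lift apex (apex , lift x , lift y)
  new₂ : ∀ {x y} → x ∈T face Γ f → y ∈T face Γ f → x ≢ y → Origin Γ f lift apex (lift x , apex , lift y)
  new₃ : ∀ {x y} → x ∈T face Γ f → y ∈T face Γ f → x ≢ y → Origin Γ f lift apex (lift x , lift y , apex)

-- The analysis of zigzags sees the subdivision only through this interface: `flag-old` and
-- `flag-new` produce its flags, and `origin` says that, up to the position of the apex, there are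
-- no others.
record Subdivision (Γ : Triangulation) (f : Face Γ) : Set where
  field
    Γ'          : Triangulation
    lift        : Fin (nV Γ) → Fin (nV Γ')
    apex        : Fin (nV Γ')
    lift-inj    : ∀ {x y} → lift x ≡ lift y → x ≡ y
    lift≢apex   : ∀ {x} → lift x ≢ apex
    isSum       : ConnectedSum Γ tetrahedron Γ'
    flag-old    : ∀ {s} → Flag Γ s → Outer Γ f s → Flag Γ' (mapTri lift s)
    flag-new    : ∀ {x y} → x ∈T face Γ f → y ∈T face Γ f → x ≢ y → Flag Γ' (apex , lift x , lift y)
    origin      : ∀ {t} → Flag Γ' t → Origin Γ f lift apex t

-- `punchIn` for a number that is not syntactically a successor, such as the number of faces; it
-- enumerates the faces other than `f`.
skip : ∀ {L} → Fin L → Fin (ℕ.pred L) → Fin L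
skip {suc L} = Fin.punchIn

skip≢ : ∀ {L} (f : Fin L) j → skip f j ≢ f
skip≢ {suc L} = Finₚ.punchInᵢ≢i

skip-injective : ∀ {L} (f : Fin L) {i j} → skip f i ≡ skip f j → i ≡ j
skip-injective {suc L} f = Finₚ.punchIn-injective f _ _

skip-surjective : ∀ {L} (f : Fin L) {i} → i ≢ f → ∃[ j ] skip f j ≡ i
skip-surjective {suc L} f i≢f = Fin.punchOut (≢-sym i≢f) , Finₚ.punchIn-punchOut (≢-sym i≢f)

∈T-map : ∀ {m n} (g : Fin m → Fin n) {v} t → v ∈T t → g v ∈T mapTri g t
∈T-map g t = Sum.map (cong g) (Sum.map (cong g) (cong g))

-- The cone over a triangle

module _ {n : ℕ} (F : Tri n) (F-proper : ProperTri F) where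

  private
    a = proj₁ F
    b = proj₁ (proj₂ F)
    c = proj₂ (proj₂ F)
    a≢b = proj₁ F-proper
    b≢c = proj₁ (proj₂ F-proper)
    a≢c = proj₂ (proj₂ F-proper)

  cone : Fin 3 → Tri (suc n)
  cone zero = zero , suc b , suc c
  cone (suc zero) = zero , suc a , suc c
  cone (suc (suc zero)) = zero , suc a , suc b

  cone-proper : ∀ k → ProperTri (cone k)
  cone-proper zero = (λ ()) , b≢c ∘ Finₚ.suc-injective , λ ()
  cone-proper (suc zero) = (λ ()) , a≢c ∘ Finₚ.suc-injective , λ ()
  cone-proper (suc (suc zero)) = (λ ()) , a≢b ∘ Finₚ.suc-injective , λ ()

  apex∈cone : ∀ k → zero ∈T cone k
  apex∈cone zero = inj₁ refl
  apex∈cone (suc zero) = inj₁ refl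
  apex∈cone (suc (suc zero)) = inj₁ refl

  cone⇒∈ : ∀ k {x} → suc x ∈T cone k → x ∈T F
  cone⇒∈ zero snd∈ = snd∈
  cone⇒∈ zero thd∈ = thd∈
  cone⇒∈ (suc zero) snd∈ = inj₁ refl
  cone⇒∈ (suc zero) thd∈ = thd∈
  cone⇒∈ (suc (suc zero)) snd∈ = inj₁ refl
  cone⇒∈ (suc (suc zero)) thd∈ = snd∈

  private
    a∉ : ¬ (suc a ∈T cone zero)
    a∉ (inj₂ (inj₁ e)) = a≢b (Finₚ.suc-injective e)
    a∉ (inj₂ (inj₂ e)) = a≢c (Finₚ.suc-injective e)

    b∉ : ¬ (suc b ∈T cone (suc zero))
    b∉ (inj₂ (inj₁ e)) = a≢b (sym (Finₚ.suc-injective e))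
    b∉ (inj₂ (inj₂ e)) = b≢c (Finₚ.suc-injective e)

    c∉ : ¬ (suc c ∈T cone (suc (suc zero)))
    c∉ (inj₂ (inj₁ e)) = a≢c (sym (Finₚ.suc-injective e))
    c∉ (inj₂ (inj₂ e)) = b≢c (sym (Finₚ.suc-injective e))

  -- Supplies the two faces at the edge from the apex to `x`.
  cone-star : ∀ {x} → x ∈T F → ∃[ k ] ∃[ l ] (k ≢ l × suc x ∈T cone k × suc x ∈T cone l ×
                (∀ m → suc x ∈T cone m → m ≡ k ⊎ m ≡ l))
  cone-star fst∈ = suc zero , suc (suc zero) , (λ ()) , snd∈ , snd∈ ,
    λ { zero p → ⊥-elim (a∉ p) ; (suc zero) _ → inj₁ refl ; (suc (suc zero)) _ → inj₂ refl }
  cone-star snd∈ = zero , suc (suc zero) , (λ ()) , snd∈ , thd∈ ,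
    λ { zero p → inj₁ refl ; (suc zero) p → ⊥-elim (b∉ p) ; (suc (suc zero)) _ → inj₂ refl }
  cone-star thd∈ = zero , suc zero , (λ ()) , thd∈ , thd∈ ,
    λ { zero p → inj₁ refl ; (suc zero) _ → inj₂ refl ; (suc (suc zero)) p → ⊥-elim (c∉ p) }

  -- The cone triangle found here takes the place of `F` as a face at the edge `xy`.
  cone-edge : ∀ {x y} → x ∈T F → y ∈T F → x ≢ y → ∃[ k ] (suc x ∈T cone k × suc y ∈T cone k ×
                (∀ m → suc x ∈T cone m → suc y ∈T cone m → m ≡ k))
  cone-edge fst∈ fst∈ n = ⊥-elim (n refl)
  cone-edge fst∈ snd∈ n = suc (suc zero) , snd∈ , thd∈ ,
    λ { zero p q → ⊥-elim (a∉ p) ; (suc zero) p q → ⊥-elim (b∉ q) ; (suc (suc zero)) p q → refl }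
  cone-edge fst∈ thd∈ n = suc zero , snd∈ , thd∈ ,
    λ { zero p q → ⊥-elim (a∉ p) ; (suc zero) p q → refl ; (suc (suc zero)) p q → ⊥-elim (c∉ q) }
  cone-edge snd∈ fst∈ n = suc (suc zero) , thd∈ , snd∈ ,
    λ { zero p q → ⊥-elim (a∉ q) ; (suc zero) p q → ⊥-elim (b∉ p) ; (suc (suc zero)) p q → refl }
  cone-edge snd∈ snd∈ n = ⊥-elim (n refl)
  cone-edge snd∈ thd∈ n = zero , snd∈ , thd∈ ,
    λ { zero p q → refl ; (suc zero) p q → ⊥-elim (b∉ p) ; (suc (suc zero)) p q → ⊥-elim (c∉ q) }
  cone-edge thd∈ fst∈ n = suc zero , thd∈ , snd∈ ,
    λ { zero p q → ⊥-elim (a∉ q) ; (suc zero) p q → refl ; (suc (suc zero)) p q → ⊥-elim (c∉ p) }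
  cone-edge thd∈ snd∈ n = zero , thd∈ , snd∈ ,
    λ { zero p q → refl ; (suc zero) p q → ⊥-elim (b∉ q) ; (suc (suc zero)) p q → ⊥-elim (c∉ p) }
  cone-edge thd∈ thd∈ n = ⊥-elim (n refl)

  cone-common : ∀ k l → ∃[ x ] (suc x ∈T cone k × suc x ∈T cone l)
  cone-common zero zero = b , snd∈ , snd∈
  cone-common zero (suc zero) = c , thd∈ , thd∈
  cone-common zero (suc (suc zero)) = b , snd∈ , thd∈
  cone-common (suc zero) zero = c , thd∈ , thd∈
  cone-common (suc zero) (suc zero) = a , snd∈ , snd∈
  cone-common (suc zero) (suc (suc zero)) = a , snd∈ , snd∈
  cone-common (suc (suc zero)) zero = b , thd∈ , snd∈
  cone-common (suc (suc zero)) (suc zero) = a , snd∈ , snd∈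
  cone-common (suc (suc zero)) (suc (suc zero)) = a , snd∈ , snd∈

  cone-noDup : ∀ k l → SameTri (cone k) (cone l) → k ≡ l
  cone-noDup zero zero s = refl
  cone-noDup zero (suc zero) s = ⊥-elim (b∉ (proj₁ (s (suc b)) snd∈))
  cone-noDup zero (suc (suc zero)) s = ⊥-elim (c∉ (proj₁ (s (suc c)) thd∈))
  cone-noDup (suc zero) zero s = ⊥-elim (a∉ (proj₁ (s (suc a)) snd∈))
  cone-noDup (suc zero) (suc zero) s = refl
  cone-noDup (suc zero) (suc (suc zero)) s = ⊥-elim (c∉ (proj₁ (s (suc c)) thd∈))
  cone-noDup (suc (suc zero)) zero s = ⊥-elim (a∉ (proj₁ (s (suc a)) snd∈))
  cone-noDup (suc (suc zero)) (suc zero) s = ⊥-elim (b∉ (proj₁ (s (suc b)) thd∈))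
  cone-noDup (suc (suc zero)) (suc (suc zero)) s = refl

-- Construction of the subdivision

module Subdivide (Γ : Triangulation) (f : Face Γ) where

  private
    n = nV Γ
    F = face Γ f
    m = ℕ.pred (length (faces Γ))
    Fp = proper Γ f

  ix : Set
  ix = Fin (3 ℕ.+ m)

  data View : ix → Set where
    inner : ∀ k → View (k Fin.↑ˡ m)
    outer : ∀ j → View (3 Fin.↑ʳ j)

  view : ∀ i → View i
  view zero = inner zero
  view (suc zero) = inner (suc zero)
  view (suc (suc zero)) = inner (suc (suc zero))
  view (suc (suc (suc j))) = outer j

  tri : ix → Tri (suc n)
  tri zero = cone F Fp zero
  tri (suc zero) = cone F Fp (suc zero)
  tri (suc (suc zero)) = cone F Fp (suc (suc zero))
  tri (suc (suc (suc j))) = mapTri suc (face Γ (skip f j))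

  tri-inner : ∀ k → tri (k Fin.↑ˡ m) ≡ cone F Fp k
  tri-inner zero = refl
  tri-inner (suc zero) = refl
  tri-inner (suc (suc zero)) = refl

  ∈-inner : ∀ {v} k → v ∈T cone F Fp k → v ∈T tri (k Fin.↑ˡ m)
  ∈-inner {v} k = subst (v ∈T_) (sym (tri-inner k))

  inner-∈ : ∀ {v} k → v ∈T tri (k Fin.↑ˡ m) → v ∈T cone F Fp k
  inner-∈ {v} k = subst (v ∈T_) (tri-inner k)

  -- The face of `Γ` that geometrically contains the given face; incidences of old vertices and
  -- edges are transported along this map.
  parent : ix → Face Γ
  parent zero = f
  parent (suc zero) = f
  parent (suc (suc zero)) = f
  parent (suc (suc (suc j))) = skip f j

  parent-inner : ∀ k → parent (k Fin.↑ˡ m) ≡ f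
  parent-inner zero = refl
  parent-inner (suc zero) = refl
  parent-inner (suc (suc zero)) = refl

  ∈-map⁻ : ∀ {x} (t : Tri n) → suc x ∈T mapTri suc t → x ∈T t
  ∈-map⁻ t = Sum.map Finₚ.suc-injective (Sum.map Finₚ.suc-injective Finₚ.suc-injective)

  zero∉map : ∀ t → ¬ (zero ∈T mapTri {n} suc t)
  zero∉map t (inj₂ (inj₁ ()))
  zero∉map t (inj₂ (inj₂ ()))

  ∈-parent : ∀ i {x} → suc x ∈T tri i → x ∈T face Γ (parent i)
  ∈-parent i p with view i
  ... | inner k = subst (λ j → _ ∈T face Γ j) (sym (parent-inner k)) (cone⇒∈ F Fp k (inner-∈ k p))
  ... | outer j = ∈-map⁻ (face Γ (skip f j)) p

  zero-inner : ∀ i → zero ∈T tri i → ∃[ k ] i ≡ k Fin.↑ˡ m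
  zero-inner i p with view i
  ... | inner k = k , refl
  ... | outer j = ⊥-elim (zero∉map (face Γ (skip f j)) p)

  same-parent : ∀ i j → parent i ≡ parent j → (∃₂ λ k l → i ≡ k Fin.↑ˡ m × j ≡ l Fin.↑ˡ m) ⊎ i ≡ j
  same-parent i j e with view i | view j
  ... | inner k | inner l = inj₁ (k , l , refl , refl)
  ... | inner k | outer j = ⊥-elim (skip≢ f j (trans (sym e) (parent-inner k)))
  ... | outer j | inner l = ⊥-elim (skip≢ f j (trans e (parent-inner l)))
  ... | outer j | outer j' = inj₂ (cong (3 Fin.↑ʳ_) (skip-injective f e))

  -- Lets old edges keep exactly two faces and link steps of `Γ` be lifted: an edge of `f` belongs
  -- to a single cone triangle, and the other faces are unchanged.
  child : ∀ i {x y} → x ≢ y → x ∈T face Γ i → y ∈T face Γ i →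
    ∃[ k ] (parent k ≡ i × suc x ∈T tri k × suc y ∈T tri k ×
            (∀ l → suc x ∈T tri l → suc y ∈T tri l → parent l ≡ i → l ≡ k))
  child i {x} {y} x≢y p q with i Fin.≟ f
  ... | yes refl = let k , u , v , only = cone-edge F Fp p q x≢y in
        k Fin.↑ˡ m , parent-inner k , ∈-inner k u , ∈-inner k v , λ l u' v' e → go k only l u' v' e
    where
    go : ∀ k → (∀ k' → suc x ∈T cone F Fp k' → suc y ∈T cone F Fp k' → k' ≡ k) →
         ∀ l → suc x ∈T tri l → suc y ∈T tri l → parent l ≡ f → l ≡ k Fin.↑ˡ m
    go k only l u v e with view l
    ... | inner k' = cong (Fin._↑ˡ m) (only k' (inner-∈ k' u) (inner-∈ k' v))
    ... | outer j = ⊥-elim (skip≢ f j e)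
  ... | no i≢f with skip-surjective f i≢f
  ...   | j , refl = 3 Fin.↑ʳ j , refl , ∈T-map suc (face Γ i) p , ∈T-map suc (face Γ i) q , only
    where
    only : ∀ l → suc x ∈T tri l → suc y ∈T tri l → parent l ≡ skip f j → l ≡ 3 Fin.↑ʳ j
    only l _ _ e with same-parent l (3 Fin.↑ʳ j) e
    ... | inj₁ (_ , zero , _ , ())
    ... | inj₁ (_ , suc zero , _ , ())
    ... | inj₁ (_ , suc (suc zero) , _ , ())
    ... | inj₂ e' = e'

  tri-proper : ∀ i → ProperTri (tri i)
  tri-proper i with view i
  ... | inner k = subst ProperTri (sym (tri-inner k)) (cone-proper F Fp k)
  ... | outer j = let p , q , r = proper Γ (skip f j) in
        p ∘ Finₚ.suc-injective , q ∘ Finₚ.suc-injective , r ∘ Finₚ.suc-injective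

  tri-noDup : ∀ i j → SameTri (tri i) (tri j) → i ≡ j
  tri-noDup i j same with view i | view j
  ... | inner k | inner l = cong (Fin._↑ˡ m) (cone-noDup F Fp k l (subst₂ SameTri (tri-inner k) (tri-inner l) same))
  ... | inner k | outer j = ⊥-elim (zero∉map (face Γ (skip f j)) (proj₁ (same zero) (∈-inner k (apex∈cone F Fp k))))
  ... | outer j | inner k = ⊥-elim (zero∉map (face Γ (skip f j)) (proj₂ (same zero) (∈-inner k (apex∈cone F Fp k))))
  ... | outer i | outer j = cong (3 Fin.↑ʳ_) (skip-injective f (noDup Γ _ _ λ v →
        ∈-map⁻ _ ∘ proj₁ (same (suc v)) ∘ ∈T-map suc (face Γ (skip f i)) ,
        ∈-map⁻ _ ∘ proj₂ (same (suc v)) ∘ ∈T-map suc (face Γ (skip f j))))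

  tri-covers : ∀ v → ∃[ i ] (v ∈T tri i)
  tri-covers zero = zero , inj₁ refl
  tri-covers (suc x) with covers Γ x
  ... | i , p with i Fin.≟ f
  ...   | yes refl = let k , _ , _ , u , _ = cone-star F Fp p in k Fin.↑ˡ m , ∈-inner k u
  ...   | no i≢f with skip-surjective f i≢f
  ...     | j , refl = 3 Fin.↑ʳ j , ∈T-map suc (face Γ i) p

  TwoFaces : Edge (suc n) → Set
  TwoFaces e = ∃[ j ] ∃[ k ] (j ≢ k × EdgeIn e (tri j) × EdgeIn e (tri k) × (∀ l → EdgeIn e (tri l) → l ≡ j ⊎ l ≡ k))

  spoke : ∀ {x} → x ∈T F → TwoFaces (zero , suc x)
  spoke {x} x∈ = let k , l , k≢l , p , q , only = cone-star F Fp x∈ in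
    k Fin.↑ˡ m , l Fin.↑ˡ m , k≢l ∘ Finₚ.↑ˡ-injective m k l ,
    (∈-inner k (apex∈cone F Fp k) , ∈-inner k p) , (∈-inner l (apex∈cone F Fp l) , ∈-inner l q) ,
    λ { i (z , u) → go k l only i z u }
    where
    go : ∀ k l → (∀ k' → suc x ∈T cone F Fp k' → k' ≡ k ⊎ k' ≡ l) →
         ∀ i → zero ∈T tri i → suc x ∈T tri i → i ≡ k Fin.↑ˡ m ⊎ i ≡ l Fin.↑ˡ m
    go k l only i z u with zero-inner i z
    ... | k' , refl = Sum.map (cong (Fin._↑ˡ m)) (cong (Fin._↑ˡ m)) (only k' (inner-∈ k' u))

  spoke-end : ∀ i {x} → zero ∈T tri i → suc x ∈T tri i → x ∈T F
  spoke-end i z p with zero-inner i z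
  ... | k , refl = cone⇒∈ F Fp k (inner-∈ k p)

  tri-edgeTwo : ∀ e → proj₁ e ≢ proj₂ e → ∀ i → EdgeIn e (tri i) → TwoFaces e
  tri-edgeTwo (zero , zero) n i p = ⊥-elim (n refl)
  tri-edgeTwo (zero , suc x) n i (z , p) = spoke (spoke-end i z p)
  tri-edgeTwo (suc x , zero) n i (p , z) =
    let j , k , j≢k , (u , v) , (u' , v') , only = spoke (spoke-end i z p) in
    j , k , j≢k , (v , u) , (v' , u') , λ { l (s , t) → only l (t , s) }
  tri-edgeTwo (suc x , suc y) n i (p , q)
    with edgeInTwoFaces Γ (parent i) (x , y) (n ∘ cong suc) (∈-parent i p , ∈-parent i q)
  ... | j₀ , j₀≢ , (u , v) , only
    with child (parent i) (n ∘ cong suc) (∈-parent i p) (∈-parent i q) | child j₀ (n ∘ cong suc) u v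
  ... | k , ek , u₁ , v₁ , only₁ | l , el , u₂ , v₂ , only₂ =
    k , l , (λ { refl → j₀≢ (trans (sym el) ek) }) , (u₁ , v₁) , (u₂ , v₂) ,
    λ { i' (p' , q') → Sum.map (only₁ i' p' q') (only₂ i' p' q') (only (parent i') (∈-parent i' p' , ∈-parent i' q')) }

  TriLink : Fin (suc n) → ix → ix → Set
  TriLink v i j = ∃[ w ] (w ≢ v × EdgeIn (v , w) (tri i) × EdgeIn (v , w) (tri j))

  inner-link : ∀ x k l → suc x ∈T tri (k Fin.↑ˡ m) → suc x ∈T tri (l Fin.↑ˡ m) →
               TriLink (suc x) (k Fin.↑ˡ m) (l Fin.↑ˡ m)
  inner-link x k l p q = zero , (λ ()) , (p , ∈-inner k (apex∈cone F Fp k)) , (q , ∈-inner l (apex∈cone F Fp l))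

  sibling-link : ∀ x i j → parent i ≡ parent j → suc x ∈T tri i → suc x ∈T tri j → Star (TriLink (suc x)) i j
  sibling-link x i j e p q with same-parent i j e
  ... | inj₁ (k , l , refl , refl) = inner-link x k l p q ◅ ε
  ... | inj₂ refl = ε

  -- Each link step of `Γ` lifts to the children at its edge. Two different children of `f` at `x`
  -- share the edge from `x` to the apex, which connects successive lifts.
  lift-link : ∀ x {i j} → Star (LinkStep (faces Γ) x) i j → ∀ k l → parent k ≡ i → parent l ≡ j →
              suc x ∈T tri k → suc x ∈T tri l → Star (TriLink (suc x)) k l
  lift-link x ε k l e e' p q = sibling-link x k l (trans e (sym e')) p q
  lift-link x {i} (_◅_ {j = i'} (w , w≢x , (u , v) , (u' , v')) ls) k l e e' p q
    with child i (≢-sym w≢x) u v | child i' (≢-sym w≢x) u' v'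
  ... | k₁ , e₁ , p₁ , q₁ , _ | k₂ , e₂ , p₂ , q₂ , _ =
    sibling-link x k k₁ (trans e (sym e₁)) p p₁ ◅◅
    (suc w , w≢x ∘ Finₚ.suc-injective , (p₁ , q₁) , (p₂ , q₂)) ◅
    lift-link x ls k₂ l e₂ e' p₂ q

  tri-link : ∀ v i j → v ∈T tri i → v ∈T tri j → Star (TriLink v) i j
  tri-link zero i j p q with zero-inner i p | zero-inner j q
  ... | k , refl | l , refl = let x , u , v = cone-common F Fp k l in
        (suc x , (λ ()) , (p , ∈-inner k u) , (q , ∈-inner l v)) ◅ ε
  tri-link (suc x) i j p q =
    lift-link x (vertexLink Γ x (parent i) (parent j) (∈-parent i p) (∈-parent j q)) i j refl refl p q

  TriAdj : Fin (suc n) → Fin (suc n) → Set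
  TriAdj u w = u ≢ w × ∃[ i ] EdgeIn (u , w) (tri i)

  lift-path : ∀ {x y} → Star (GraphAdj (faces Γ)) x y → Star TriAdj (suc x) (suc y)
  lift-path = Star.gmap suc λ { (x≢y , i , p , q) →
    let k , _ , u , v , _ = child i x≢y p q in x≢y ∘ Finₚ.suc-injective , k , u , v }

  tri-connected : ∀ u v → Star TriAdj u v
  tri-connected zero zero = ε
  tri-connected zero (suc y) = ((λ ()) , suc zero , inj₁ refl , snd∈) ◅ lift-path (connected Γ (proj₁ F) y)
  tri-connected (suc x) zero = lift-path (connected Γ x (proj₁ F)) ◅◅
    ((λ ()) , suc zero , snd∈ , inj₁ refl) ◅ ε
  tri-connected (suc x) (suc y) = lift-path (connected Γ x y)

  surface : IsSurface tri
  surface = record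
    { proper' = tri-proper
    ; noDup' = tri-noDup
    ; covers' = tri-covers
    ; edgeTwo = tri-edgeTwo
    ; link = tri-link
    ; connected' = tri-connected
    }

  subdivided : Triangulation
  subdivided = triangulation tri zero surface

  private
    Δ = subdivided
    pos = position tri
    Δ-face : ∀ k → face Δ k ≡ tri (pos k)
    Δ-face = lookup-position tri
    face-Δ : ∀ i → face Δ (index tri i) ≡ tri i
    face-Δ = lookup-index tri

  β : Fin 4 → Fin (suc n)
  β zero = zero
  β (suc zero) = suc (proj₁ F)
  β (suc (suc zero)) = suc (proj₁ (proj₂ F))
  β (suc (suc (suc zero))) = suc (proj₂ (proj₂ F))

  β-inj : ∀ x y → β x ≡ β y → x ≡ y
  β-inj zero zero e = refl
  β-inj (suc zero) (suc zero) e = refl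
  β-inj (suc zero) (suc (suc zero)) e = ⊥-elim (proj₁ Fp (Finₚ.suc-injective e))
  β-inj (suc zero) (suc (suc (suc zero))) e = ⊥-elim (proj₂ (proj₂ Fp) (Finₚ.suc-injective e))
  β-inj (suc (suc zero)) (suc zero) e = ⊥-elim (proj₁ Fp (sym (Finₚ.suc-injective e)))
  β-inj (suc (suc zero)) (suc (suc zero)) e = refl
  β-inj (suc (suc zero)) (suc (suc (suc zero))) e = ⊥-elim (proj₁ (proj₂ Fp) (Finₚ.suc-injective e))
  β-inj (suc (suc (suc zero))) (suc zero) e = ⊥-elim (proj₂ (proj₂ Fp) (sym (Finₚ.suc-injective e)))
  β-inj (suc (suc (suc zero))) (suc (suc zero)) e = ⊥-elim (proj₁ (proj₂ Fp) (sym (Finₚ.suc-injective e)))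
  β-inj (suc (suc (suc zero))) (suc (suc (suc zero))) e = refl
  β-inj zero (suc zero) ()
  β-inj zero (suc (suc zero)) ()
  β-inj zero (suc (suc (suc zero))) ()
  β-inj (suc zero) zero ()
  β-inj (suc (suc zero)) zero ()
  β-inj (suc (suc (suc zero))) zero ()

  ≡⇒same : ∀ {n} {t t' : Tri n} → t ≡ t' → SameTri t t'
  ≡⇒same refl v = id , id

  isSum : ConnectedSum Γ tetrahedron Δ
  isSum = record
    { f = f
    ; f' = suc (suc (suc zero))
    ; α = suc
    ; β = β
    ; α-inj = λ _ _ → Finₚ.suc-injective
    ; β-inj = β-inj
    ; g-image = tetra (suc (suc (suc zero)))
    ; g-face = λ v → id , id
    ; glued = refl , refl , refl
    ; onlyGlued = λ { x (suc zero) e → inj₁ (Finₚ.suc-injective e , refl)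
                    ; x (suc (suc zero)) e → inj₂ (inj₁ (Finₚ.suc-injective e , refl))
                    ; x (suc (suc (suc zero))) e → inj₂ (inj₂ (Finₚ.suc-injective e , refl)) }
    ; vertexCover = λ { zero → inj₂ (zero , refl) ; (suc x) → inj₁ (x , refl) }
    ; facesFrom = λ k → from k (pos k) (Δ-face k)
    ; facesG = λ i i≢f → let j , e = skip-surjective f i≢f in
        index tri (3 Fin.↑ʳ j) , ≡⇒same (trans (face-Δ (3 Fin.↑ʳ j)) (cong (mapTri suc ∘ face Γ) e))
    ; facesH = λ { zero _ → index tri zero , ≡⇒same (face-Δ zero)
                 ; (suc zero) _ → index tri (suc zero) , ≡⇒same (face-Δ (suc zero))
                 ; (suc (suc zero)) _ → index tri (suc (suc zero)) , ≡⇒same (face-Δ (suc (suc zero)))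
                 ; (suc (suc (suc zero))) n → ⊥-elim (n refl) }
    }
    where
    from : ∀ k i → face Δ k ≡ tri i →
      (∃[ i ] (i ≢ f × SameTri (face Δ k) (mapTri suc (face Γ i)))) ⊎
      (∃[ j ] (j ≢ suc (suc (suc zero)) × SameTri (face Δ k) (mapTri β (face tetrahedron j))))
    from k zero e = inj₂ (zero , (λ ()) , ≡⇒same e)
    from k (suc zero) e = inj₂ (suc zero , (λ ()) , ≡⇒same e)
    from k (suc (suc zero)) e = inj₂ (suc (suc zero) , (λ ()) , ≡⇒same e)
    from k (suc (suc (suc j))) e = inj₁ (skip f j , skip≢ f j , ≡⇒same e)

  flag-tri : ∀ {t} → ProperTri t → ∀ i → t ⊆T tri i → Flag Δ t
  flag-tri {t} p i q = flag p (index tri i) (subst (t ⊆T_) (sym (face-Δ i)) q)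

  flag-old : ∀ {s} → Flag Γ s → Outer Γ f s → Flag Δ (mapTri suc s)
  flag-old {x , y , z} (flag (p , q , r) i (x∈ , y∈ , z∈)) o
    with skip-surjective f {i} (λ { refl → o (x∈ , y∈ , z∈) })
  ... | j , refl = flag-tri (p ∘ Finₚ.suc-injective , q ∘ Finₚ.suc-injective , r ∘ Finₚ.suc-injective) (3 Fin.↑ʳ j)
        (∈T-map suc (face Γ i) x∈ , ∈T-map suc (face Γ i) y∈ , ∈T-map suc (face Γ i) z∈)

  flag-new : ∀ {x y} → x ∈T F → y ∈T F → x ≢ y → Flag Δ (zero , suc x , suc y)
  flag-new x∈ y∈ x≢y = let k , u , v , _ = cone-edge F Fp x∈ y∈ x≢y in
    flag-tri ((λ ()) , x≢y ∘ Finₚ.suc-injective , λ ()) (k Fin.↑ˡ m)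
      (∈-inner k (apex∈cone F Fp k) , ∈-inner k u , ∈-inner k v)

  origin : ∀ {t} → Flag Δ t → Origin Γ f suc zero t
  origin {t} (flag d k p) = go t d (pos k) (subst (t ⊆T_) (Δ-face k) p)
    where
    go : ∀ t → ProperTri t → ∀ i → t ⊆T tri i → Origin Γ f suc zero t
    go (zero , zero , _) (d , _) i _ = ⊥-elim (d refl)
    go (zero , suc _ , zero) (_ , _ , d) i _ = ⊥-elim (d refl)
    go (suc _ , zero , zero) (_ , d , _) i _ = ⊥-elim (d refl)
    go (zero , suc x , suc y) (_ , d , _) i (z , p , q) =
      new₁ (spoke-end i z p) (spoke-end i z q) (d ∘ cong suc)
    go (suc x , zero , suc y) (_ , _ , d) i (p , z , q) =
      new₂ (spoke-end i z p) (spoke-end i z q) (d ∘ cong suc)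
    go (suc x , suc y , zero) (d , _ , _) i (p , q , z) =
      new₃ (spoke-end i z p) (spoke-end i z q) (d ∘ cong suc)
    go t@(suc x , suc y , suc z) d@(d₁ , d₂ , d₃) i s⊆@(p , q , r) with view i
    -- A flag of a cone triangle must use the apex `zero`, but here all three vertices are old.
    ... | inner k with ⊆T⇒⊇ t (tri (k Fin.↑ˡ m)) d s⊆ (∈-inner k (apex∈cone F Fp k))
    ...   | inj₁ ()
    ...   | inj₂ (inj₁ ())
    ...   | inj₂ (inj₂ ())
    go t@(suc x , suc y , suc z) d@(d₁ , d₂ , d₃) i s⊆@(p , q , r) | outer j =
      old (x , y , z) φ λ s⊆f → skip≢ f j (flag-at-unique φ (skip f j) f (Flag.inside φ) s⊆f)
      where
      φ : Flag Γ (x , y , z)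
      φ = flag (d₁ ∘ cong suc , d₂ ∘ cong suc , d₃ ∘ cong suc) (skip f j)
            (∈-map⁻ (face Γ (skip f j)) p , ∈-map⁻ (face Γ (skip f j)) q , ∈-map⁻ (face Γ (skip f j)) r)

abstract
  subdivide : ∀ Γ f → Subdivision Γ f
  subdivide Γ f = record
    { Γ' = subdivided
    ; lift = suc
    ; apex = zero
    ; lift-inj = Finₚ.suc-injective
    ; lift≢apex = λ ()
    ; isSum = isSum
    ; flag-old = flag-old
    ; flag-new = flag-new
    ; origin = origin
    }
    where open Subdivide Γ f

shredding-trans : ∀ {Γ₁ Γ₂ Γ₃} → Shredding Γ₁ Γ₂ → Shredding Γ₂ Γ₃ → Shredding Γ₁ Γ₃
shredding-trans p none = p
shredding-trans p (step S s q c) = step S s (shredding-trans p q) c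

-- Classes of zigzags at the corners of a face

data Arrangement {A : Set} (x y z : A) : A → A → A → Set where
  xyz : Arrangement x y z x y z
  yzx : Arrangement x y z y z x
  zxy : Arrangement x y z z x y
  zyx : Arrangement x y z z y x
  yxz : Arrangement x y z y x z
  xzy : Arrangement x y z x z y

module _ {Γ : Triangulation} {f : Face Γ} where

  arrangement : ∀ {x y z p q r} → Corner Γ f x y z → Corner Γ f p q r → Arrangement x y z p q r
  arrangement c (corner (pq , qr , pr) (p∈ , q∈ , r∈)) with corner-∈ c p∈ | corner-∈ c q∈ | corner-∈ c r∈
  ... | fst∈ | fst∈ | _ = ⊥-elim (pq refl)
  ... | snd∈ | snd∈ | _ = ⊥-elim (pq refl)
  ... | thd∈ | thd∈ | _ = ⊥-elim (pq refl)
  ... | fst∈ | _ | fst∈ = ⊥-elim (pr refl)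
  ... | snd∈ | _ | snd∈ = ⊥-elim (pr refl)
  ... | thd∈ | _ | thd∈ = ⊥-elim (pr refl)
  ... | _ | fst∈ | fst∈ = ⊥-elim (qr refl)
  ... | _ | snd∈ | snd∈ = ⊥-elim (qr refl)
  ... | _ | thd∈ | thd∈ = ⊥-elim (qr refl)
  ... | fst∈ | snd∈ | thd∈ = xyz
  ... | fst∈ | thd∈ | snd∈ = xzy
  ... | snd∈ | fst∈ | thd∈ = yxz
  ... | snd∈ | thd∈ | fst∈ = yzx
  ... | thd∈ | fst∈ | snd∈ = zxy
  ... | thd∈ | snd∈ | fst∈ = zyx

  complete-corner : ∀ {x y} → x ∈T face Γ f → y ∈T face Γ f → x ≢ y → ∃[ z ] Corner Γ f x y z
  complete-corner x∈ y∈ x≢y = let z , z∈ , x≢z , y≢z = third (face Γ f) (proper Γ f) x≢y x∈ y∈ in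
    z , corner (x≢y , y≢z , x≢z) (x∈ , y∈ , z∈)

  -- Together with `flip`, the rotations reach all six orderings of the vertices.
  rotations⇒uniform : ∀ {x y z} → Corner Γ f x y z →
    Equivalent Γ (x , y , z) (y , z , x) → Equivalent Γ (x , y , z) (z , x , y) → FaceEquivalent {Γ} f f
  rotations⇒uniform {x} {y} {z} c p q (s₁ , s₂ , s₃) (t₁ , t₂ , t₃) ps s⊆ pt t⊆ =
    ~-sym (go (arrangement c (corner ps s⊆))) ◅◅ go (arrangement c (corner pt t⊆))
    where
    go : ∀ {u v w} → Arrangement x y z u v w → Equivalent Γ (x , y , z) (u , v , w)
    go xyz = ε
    go yzx = p
    go zxy = q
    go zyx = flip ◅ ε
    go yxz = q ◅◅ flip ◅ ε
    go xzy = p ◅◅ flip ◅ ε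

  outer-run⇒~ : ∀ {s t} → Star (OuterStep Γ f) s t → Equivalent Γ s t
  outer-run⇒~ = Star.map (λ p → fwd (OuterStep.isStep p))

  -- Up to reversal a flag of `f` is given by its middle vertex; a zigzag leaving across `xy` has
  -- just turned around `x`, the tail.
  port-tail : ∀ {x y z w} → Corner Γ f x y z → Port Γ f x y w → Equivalent Γ (x , y , w) (z , x , y)
  port-tail c P = bwd (step (corner-flag (corner-rot (corner-rot c))) (Port.port-flag P) (port-apex c P)) ◅ ε

  linked-tails : ∀ {x y z p q r} → Corner Γ f x y z → Corner Γ f p q r → Linked Γ f x y p q →
                 Equivalent Γ (z , x , y) (r , p , q)
  linked-tails c d l = let _ , P = port-exists c
                           _ , Q = port-exists d
                       in ~-sym (port-tail c P) ◅◅ outer-run⇒~ (l P Q) ◅◅ flip ◅ port-tail d Q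

  -- Only a link between the two directed edges with tail `x` fails to connect the corner `x` with
  -- another corner.
  tail-linking : ∀ {x y z} → Corner Γ f x y z →
    Linked Γ f x y x z ⊎ Equivalent Γ (z , x , y) (x , y , z) ⊎ Equivalent Γ (z , x , y) (y , z , x)
  tail-linking c with linking c
  ... | to-xz l = inj₁ l
  ... | to-yx l = inj₂ (inj₁ (linked-tails c (corner-rot (corner-rev c)) l ◅◅ flip ◅ ε))
  ... | to-yz l = inj₂ (inj₁ (linked-tails c (corner-rot c) l))
  ... | to-zx l = inj₂ (inj₂ (linked-tails c (corner-rot (corner-rot c)) l))
  ... | to-zy l = inj₂ (inj₂ (linked-tails c (corner-rev c) l ◅◅ flip ◅ ε))

  -- A graph on the three corners of f without isolated vertices is connected.
  self-linked-or-uniform :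
    (∃[ x ] ∃[ y ] ∃[ z ] (Corner Γ f x y z × Linked Γ f x y x z)) ⊎ FaceEquivalent {Γ} f f
  self-linked-or-uniform = go (tail-linking c) (tail-linking (corner-rot c)) (tail-linking (corner-rot (corner-rot c)))
    where
    c : Corner Γ f _ _ _
    c = corner (proper Γ f) ⊆T-refl
    x = proj₁ (face Γ f)
    y = proj₁ (proj₂ (face Γ f))
    z = proj₂ (proj₂ (face Γ f))
    go : Linked Γ f x y x z ⊎ Equivalent Γ (z , x , y) (x , y , z) ⊎ Equivalent Γ (z , x , y) (y , z , x) →
         Linked Γ f y z y x ⊎ Equivalent Γ (x , y , z) (y , z , x) ⊎ Equivalent Γ (x , y , z) (z , x , y) →
         Linked Γ f z x z y ⊎ Equivalent Γ (y , z , x) (z , x , y) ⊎ Equivalent Γ (y , z , x) (x , y , z) →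
         (∃[ x ] ∃[ y ] ∃[ z ] (Corner Γ f x y z × Linked Γ f x y x z)) ⊎ FaceEquivalent {Γ} f f
    go (inj₁ l) _ _ = inj₁ (x , y , z , c , l)
    go _ (inj₁ l) _ = inj₁ (y , z , x , corner-rot c , l)
    go _ _ (inj₁ l) = inj₁ (z , x , y , corner-rot (corner-rot c) , l)
    go (inj₂ (inj₁ p)) _ (inj₂ (inj₁ q)) = inj₂ (rotations⇒uniform c (~-sym p ◅◅ ~-sym q) (~-sym p))
    go (inj₂ (inj₁ p)) _ (inj₂ (inj₂ q)) = inj₂ (rotations⇒uniform c (~-sym q) (~-sym p))
    go (inj₂ (inj₂ p)) (inj₂ (inj₁ q)) _ = inj₂ (rotations⇒uniform c q (q ◅◅ ~-sym p))
    go (inj₂ (inj₂ p)) (inj₂ (inj₂ q)) _ = inj₂ (rotations⇒uniform c (q ◅◅ p) q)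

-- Merging the zigzags of a face

-- By `outer-step` the pieces of zigzags outside `f` survive; by `represented` no class lives inside
-- the patch replacing `f` alone, so no new classes arise.
record Refinement (Γ : Triangulation) (f : Face Γ) : Set where
  field
    Γ*          : Triangulation
    shredding   : Shredding Γ Γ*
    embed       : Fin (nV Γ) → Fin (nV Γ*)
    outer-step  : ∀ {s t} → OuterStep Γ f s t → Step Γ* (mapTri embed s) (mapTri embed t)
    represented : ∀ {t} → Flag Γ* t → ∃[ s ] (Flag Γ s × Outer Γ f s × Equivalent Γ* t (mapTri embed s))

  Joined : (x y x' y' : Fin (nV Γ)) → Set
  Joined x y x' y' = ∀ {w w'} → Port Γ f x y w → Port Γ f x' y' w' →
    Equivalent Γ* (mapTri embed (x , y , w)) (mapTri embed (x' , y' , w'))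

  linked⇒joined : ∀ {x y x' y'} → Linked Γ f x y x' y' → Joined x y x' y'
  linked⇒joined l P Q = Star.gmap (mapTri embed) (λ p → fwd (outer-step p)) (l P Q) ◅◅ flip ◅ ε

  joined-sym : ∀ {x y x' y'} → Joined x y x' y' → Joined x' y' x y
  joined-sym j P Q = ~-sym (j Q P)

  -- As `Joined` quantifies over ports, the corner is there to supply the port in the middle.
  joined-trans : ∀ {x y x' y' z' x'' y''} → Corner Γ f x' y' z' →
    Joined x y x' y' → Joined x' y' x'' y'' → Joined x y x'' y''
  joined-trans c j j' P R = let _ , Q = port-exists c in j P Q ◅◅ j' Q R

  joined-refl : ∀ {x y z} → Corner Γ f x y z → Joined x y x y
  joined-refl c P Q with port-unique c P Q
  ... | refl = ε

record Merging (Γ : Triangulation) (f : Face Γ) : Set where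
  field
    refinement : Refinement Γ f
  open Refinement refinement public
  field
    hub      : Tri (nV Γ*)
    port-hub : ∀ {x y z w} → Corner Γ f x y z → Port Γ f x y w → Equivalent Γ* (mapTri embed (x , y , w)) hub

module _ {Γ : Triangulation} {f : Face Γ} (R : Refinement Γ f) where
  open Refinement R

  joined⇒merging : ∀ {a b c} → Corner Γ f a b c →
    Joined a b b a → Joined a b a c → Joined a b c a → Joined a b b c → Joined a b c b → Merging Γ f
  joined⇒merging {a} {b} {c} C ba ac ca bc cb = record
    { refinement = R
    ; hub = mapTri embed (a , b , proj₁ (port-exists C))
    ; port-hub = λ D P → ~-sym (go (arrangement C D) (proj₂ (port-exists C)) P)
    }
    where
    go : ∀ {x y z} → Arrangement a b c x y z → Joined a b x y
    go xyz = joined-refl C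
    go yzx = bc
    go zxy = ca
    go zyx = cb
    go yxz = ba
    go xzy = ac

-- The representatives need not be flags, so that the initial cover can use all triples.
record Cover (Γ : Triangulation) (m : ℕ) : Set where
  field
    rep   : Fin m → Tri (nV Γ)
    class : ∀ {s} → Flag Γ s → Fin m
    same  : ∀ {s} (φ : Flag Γ s) → Equivalent Γ (rep (class φ)) s

module _ {Γ : Triangulation} where

  -- The representative `i` is dropped and its label redirected to that of `j`.
  identify : ∀ {m} (C : Cover Γ (suc m)) {i j} → i ≢ j → Equivalent Γ (Cover.rep C i) (Cover.rep C j) → Cover Γ m
  identify C {i} {j} i≢j i~j = record
    { rep = rep ∘ Fin.punchIn i
    ; class = λ φ → proj₁ (find (class φ))
    ; same = λ φ → proj₂ (find (class φ)) ◅◅ same φ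
    }
    where
    open Cover C
    find : ∀ k → ∃[ l ] Equivalent Γ (rep (Fin.punchIn i l)) (rep k)
    find k with i Fin.≟ k
    ... | yes refl = Fin.punchOut i≢j ,
          subst (λ l → Equivalent Γ (rep l) (rep i)) (sym (Finₚ.punchIn-punchOut i≢j)) (~-sym i~j)
    ... | no i≢k = Fin.punchOut i≢k ,
          subst (λ l → Equivalent Γ (rep l) (rep k)) (sym (Finₚ.punchIn-punchOut i≢k)) ε

  identify-classes : ∀ {m} (C : Cover Γ (suc m)) {s t} (φ : Flag Γ s) (ψ : Flag Γ t) →
    Cover.class C φ ≢ Cover.class C ψ → Equivalent Γ s t → Cover Γ m
  identify-classes C φ ψ n p = identify C n (Cover.same C φ ◅◅ p ◅◅ ~-sym (Cover.same C ψ))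

module _ {Γ : Triangulation} {f : Face Γ} (M : Merging Γ f) where
  open Merging M

  -- The face `f` is gone from `Γ*`, so its flags are all sent to the hub; equivalences survive
  -- because every port is equivalent to the hub.
  collapse : Tri (nV Γ) → Tri (nV Γ*)
  collapse s with s ⊆T? face Γ f
  ... | yes _ = hub
  ... | no _ = mapTri embed s

  collapse-inner : ∀ {s} → s ⊆T face Γ f → collapse s ≡ hub
  collapse-inner {s} p with s ⊆T? face Γ f
  ... | yes _ = refl
  ... | no o = ⊥-elim (o p)

  collapse-outer : ∀ {s} → Outer Γ f s → collapse s ≡ mapTri embed s
  collapse-outer {s} o with s ⊆T? face Γ f
  ... | yes p = ⊥-elim (o p)
  ... | no _ = refl

  collapse-step : ∀ {s t} → Step Γ s t → Equivalent Γ* (collapse s) (collapse t)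
  collapse-step {s} {t} p with s ⊆T? face Γ f | t ⊆T? face Γ f
  ... | yes _ | yes _ = ε
  ... | no o | no o' = fwd (outer-step (outerStep p o o')) ◅ ε
  -- The outer flag, reversed, is a port flag; the chain of rotations names the directed edge it
  -- lies over.
  collapse-step (step φ ψ _) | no o | yes i = flip ◅
    port-hub (corner-rot (corner-rev (corner-rot (corner-rot (corner-rot (corner (Flag.distinct ψ) i))))))
      (port (flag-rev φ) (o ∘ ⊆T-rev))
  collapse-step (step φ ψ _) | yes i | no o =
    ~-sym (port-hub (corner-rot (corner (Flag.distinct φ) i)) (port ψ o))

  collapse-rev : ∀ s → Equivalent Γ* (collapse s) (collapse (rev s))
  collapse-rev s with s ⊆T? face Γ f | rev s ⊆T? face Γ f
  ... | yes _ | yes _ = ε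
  ... | no _ | no _ = flip ◅ ε
  ... | yes p | no o = ⊥-elim (o (⊆T-rev p))
  ... | no o | yes p = ⊥-elim (o (⊆T-rev p))

  collapse-~ : ∀ {s t} → Equivalent Γ s t → Equivalent Γ* (collapse s) (collapse t)
  collapse-~ ε = ε
  collapse-~ (fwd p ◅ ps) = collapse-step p ◅◅ collapse-~ ps
  collapse-~ (bwd p ◅ ps) = ~-sym (collapse-step p) ◅◅ collapse-~ ps
  collapse-~ (_◅_ {i = s} flip ps) = collapse-rev s ◅◅ collapse-~ ps

  -- Labels in `Γ*` are read off from outer flags of `Γ`, so their number does not grow.
  collapse-cover : ∀ {m} → Cover Γ m → Cover Γ* m
  collapse-cover C = record
    { rep = collapse ∘ rep
    ; class = λ φ → let _ , ψ , _ = represented φ in class ψ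
    ; same = λ φ → let s , ψ , o , p = represented φ in
        subst (Equivalent Γ* _) (collapse-outer o) (collapse-~ (same ψ)) ◅◅ ~-sym p
    }
    where open Cover C

  merged-cover : ∀ {m} (C : Cover Γ (suc m)) {s t} (φ : Flag Γ s) (ψ : Flag Γ t) →
    s ⊆T face Γ f → t ⊆T face Γ f → Cover.class C φ ≢ Cover.class C ψ → Cover Γ* m
  merged-cover C {s} {t} φ ψ s⊆ t⊆ n = identify (collapse-cover C) n
    (to-hub φ s⊆ ◅◅ ~-sym (to-hub ψ t⊆))
    where
    to-hub : ∀ {s} (φ : Flag Γ s) → s ⊆T face Γ f → Equivalent Γ* (collapse (Cover.rep C (Cover.class C φ))) hub
    to-hub φ p = subst (Equivalent Γ* _) (collapse-inner p) (collapse-~ (Cover.same C φ))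

-- The two refinements

flag₂₁₃ : ∀ {Γ x y z} → Flag Γ (x , y , z) → Flag Γ (y , x , z)
flag₂₁₃ φ = flag-rot (flag-rev φ)

module _ (Γ : Triangulation) (f : Face Γ) where

  private
    module S = Subdivision (subdivide Γ f)
  open S using (Γ'; lift; apex; lift-inj; lift≢apex)

  lift-step : ∀ {s t} → OuterStep Γ f s t → Step Γ' (mapTri lift s) (mapTri lift t)
  lift-step (outerStep (step φ ψ n) o o') = step (S.flag-old φ o) (S.flag-old ψ o') (n ∘ lift-inj)

  port-lift : ∀ {x y w} → Port Γ f x y w → Flag Γ' (lift x , lift y , lift w)
  port-lift (port φ o) = S.flag-old φ o

  cone-flag : ∀ {x y z} → Corner Γ f x y z → Flag Γ' (apex , lift x , lift y)
  cone-flag (corner (x≢y , _) (x∈ , y∈ , _)) = S.flag-new x∈ y∈ x≢y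

  enter-step : ∀ {x y z w} → Corner Γ f x y z → Port Γ f y x w →
               Step Γ' (lift w , lift x , lift y) (lift x , lift y , apex)
  enter-step c P = step (flag-rev (port-lift P)) (flag-rot (cone-flag c)) lift≢apex

  turn-step : ∀ {x y z} → Corner Γ f x y z → Step Γ' (lift x , lift y , apex) (lift y , apex , lift z)
  turn-step c@(corner (_ , _ , x≢z) _) =
    step (flag-rot (cone-flag c)) (flag₂₁₃ (cone-flag (corner-rot c))) (x≢z ∘ lift-inj)

  Represented : Tri (nV Γ') → Set
  Represented t = ∃[ s ] (Flag Γ s × Outer Γ f s × Equivalent Γ' t (mapTri lift s))

  entered : ∀ {x y z} → Corner Γ f x y z → Represented (lift x , lift y , apex)
  entered c = let _ , P@(port ψ o) = port-exists (corner-swap c) in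
    _ , flag-rev ψ , o ∘ ⊆T-rev , bwd (enter-step c P) ◅ ε

  preceded : ∀ {t t'} → Gen Γ' t t' → Represented t' → Represented t
  preceded g (s , φ , o , p) = s , φ , o , g ◅ p

  -- Up to reversal a flag at the apex is an entering flag `(x, y, apex)` or the successor of one,
  -- so at most two steps back lead out of `f`.
  cone-represented : ∀ {t} → Flag Γ' t → Represented t
  cone-represented φ with S.origin φ
  ... | old s ψ o = s , ψ , o , ε
  ... | new₁ x∈ y∈ x≢y = let _ , c = complete-corner {Γ} {f} x∈ y∈ x≢y in
        preceded flip (entered (corner-swap c))
  ... | new₂ x∈ y∈ x≢y = let _ , c = complete-corner {Γ} {f} x∈ y∈ x≢y
                             c' = corner-rot (corner-rot c)
                         in preceded (bwd (turn-step c')) (entered c')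
  ... | new₃ x∈ y∈ x≢y = let _ , c = complete-corner {Γ} {f} x∈ y∈ x≢y in entered c

  cone-refinement : Refinement Γ f
  cone-refinement = record
    { Γ* = Γ'
    ; shredding = step tetrahedron tetrahedron-sphere none S.isSum
    ; embed = lift
    ; outer-step = lift-step
    ; represented = cone-represented
    }

  open Refinement cone-refinement

  -- With `d` the apex, the zigzag through the cone runs along `yx`, `xd`, `dz`, `zy`.
  same-head⇒joined : ∀ {x y z} → Corner Γ f x y z → Joined x y z y
  same-head⇒joined c P Q =
    flip ◅ fwd (enter-step (corner-swap c) P) ◅ fwd (turn-step (corner-swap c)) ◅
    fwd (step-rev (turn-step (corner-rot c))) ◅ fwd (step-rev (enter-step (corner-rot c) Q)) ◅ ε

-- Subdividing twice

module _ {Γ : Triangulation} {f : Face Γ} {a b c : Fin (nV Γ)} (C : Corner Γ f a b c) where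

  private
    module S₁ = Subdivision (subdivide Γ f)
    Γ₁ = S₁.Γ'
    ℓ = S₁.lift
    d = S₁.apex

  f₁ : Face Γ₁
  f₁ = Flag.at (cone-flag Γ f C)

  C₁ : Corner Γ₁ f₁ d (ℓ a) (ℓ b)
  C₁ = corner (Flag.distinct (cone-flag Γ f C)) (Flag.inside (cone-flag Γ f C))

  private
    module S₂ = Subdivision (subdivide Γ₁ f₁)
    Γ₂ = S₂.Γ'
    L = S₂.lift ∘ ℓ
    D = S₂.lift d

    c≢b : c ≢ b
    c≢b = ≢-sym (proj₁ (proj₂ (Corner.corner-proper C)))

    c≢a : c ≢ a
    c≢a = ≢-sym (proj₂ (proj₂ (Corner.corner-proper C)))

  c-outer : ∀ s → ℓ c ∈T s → Outer Γ₁ f₁ s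
  c-outer s m i with corner-∈ C₁ (∈T-⊆T s _ i m)
  ... | inj₁ e = S₁.lift≢apex e
  ... | inj₂ (inj₁ e) = c≢a (S₁.lift-inj e)
  ... | inj₂ (inj₂ e) = c≢b (S₁.lift-inj e)

  -- `f₁` contains the apex `d`, which no lifted triple does.
  lifted-outer : ∀ {s} → Flag Γ₁ (mapTri ℓ s) → Outer Γ₁ f₁ (mapTri ℓ s)
  lifted-outer {s} φ i with ⊆T⇒⊇ (mapTri ℓ s) (face Γ₁ f₁) (Flag.distinct φ) i (proj₁ (Corner.corner-inside C₁))
  ... | inj₁ e = S₁.lift≢apex (sym e)
  ... | inj₂ (inj₁ e) = S₁.lift≢apex (sym e)
  ... | inj₂ (inj₂ e) = S₁.lift≢apex (sym e)

  source-flag : ∀ {Γ s t} → Step Γ s t → Flag Γ s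
  source-flag (step φ _ _) = φ

  target-flag : ∀ {Γ s t} → Step Γ s t → Flag Γ t
  target-flag (step _ ψ _) = ψ

  lift-step₂ : ∀ {s t} → OuterStep Γ f s t → Step Γ₂ (mapTri L s) (mapTri L t)
  lift-step₂ {s} {t} p = let q = lift-step Γ f p in
    lift-step Γ₁ f₁ (outerStep q (lifted-outer {s} (source-flag q)) (lifted-outer {t} (target-flag q)))

  -- Entry across an edge at `c` avoids `f₁`, so it is unaffected by the second subdivision.
  enter₂ : ∀ {x y z w} → Corner Γ f x y z → Port Γ f y x w → x ≡ c ⊎ y ≡ c →
           Step Γ₂ (L w , L x , L y) (L x , L y , D)
  enter₂ {x} {y} {z} {w} k P e = let q = enter-step Γ f k P in
    lift-step Γ₁ f₁ (outerStep q (lifted-outer {w , x , y} (source-flag q)) (c-outer (ℓ x , ℓ y , d)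
      (Sum.map (cong ℓ ∘ sym) (inj₁ ∘ cong ℓ ∘ sym) e)))

  turn₂ : ∀ {x z} → Corner Γ f x c z → Step Γ₂ (L x , L c , D) (L c , D , L z)
  turn₂ {x} {z} k = lift-step Γ₁ f₁ (outerStep (turn-step Γ f k)
    (c-outer (ℓ x , ℓ c , d) snd∈) (c-outer (ℓ c , d , ℓ z) (inj₁ refl)))

  Represented₂ : Tri (nV Γ₂) → Set
  Represented₂ t = ∃[ s ] (Flag Γ s × Outer Γ f s × Equivalent Γ₂ t (mapTri L s))

  entered₂ : ∀ {x y z} → Corner Γ f x y z → x ≡ c ⊎ y ≡ c → Represented₂ (L x , L y , D)
  entered₂ k e = let _ , P@(port ψ o) = port-exists (corner-swap k) in
    _ , flag-rev ψ , o ∘ ⊆T-rev , bwd (enter₂ k P e) ◅ ε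

  preceded₂ : ∀ {t t'} → Equivalent Γ₂ t t' → Represented₂ t' → Represented₂ t
  preceded₂ p (s , φ , o , q) = s , φ , o , p ◅◅ q

  turned₂ : ∀ {y z} → Corner Γ f c y z → Represented₂ (L c , D , L y)
  turned₂ k = let k' = corner-rot (corner-rot k) in
    preceded₂ (bwd (turn₂ k') ◅ ε) (entered₂ k' (inj₂ refl))

  c-or-in : ∀ {x} → x ∈T face Γ f → x ≡ c ⊎ ℓ x ∈T face Γ₁ f₁
  c-or-in x∈ with corner-∈ C x∈
  ... | inj₁ refl = inj₂ (proj₁ (proj₂ (Corner.corner-inside C₁)))
  ... | snd∈ = inj₂ (proj₂ (proj₂ (Corner.corner-inside C₁)))
  ... | thd∈ = inj₁ refl

  touches-c : ∀ {x y} → x ∈T face Γ f → y ∈T face Γ f → Outer Γ₁ f₁ (ℓ x , ℓ y , d) → x ≡ c ⊎ y ≡ c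
  touches-c x∈ y∈ o with c-or-in x∈ | c-or-in y∈
  ... | inj₁ e | _ = inj₁ e
  ... | inj₂ _ | inj₁ e = inj₂ e
  ... | inj₂ p | inj₂ q = ⊥-elim (o (p , q , proj₁ (Corner.corner-inside C₁)))

  -- A flag at `d` that avoids `f₁` contains `c`, so it can be traced back out of `f` by steps that
  -- avoid `f₁` as well.
  origin-represented₂ : ∀ {t} → Origin Γ f ℓ d t → Outer Γ₁ f₁ t → Represented₂ (mapTri S₂.lift t)
  origin-represented₂ (old s φ o) _ = s , φ , o , ε
  origin-represented₂ (new₁ x∈ y∈ x≢y) o = let _ , k = complete-corner {Γ} {f} x∈ y∈ x≢y in
    preceded₂ (flip ◅ ε) (entered₂ (corner-swap k) (swap (touches-c x∈ y∈ (λ { (p , q , r) → o (r , p , q) }))))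
  origin-represented₂ (new₂ x∈ y∈ x≢y) o
    with complete-corner {Γ} {f} x∈ y∈ x≢y | touches-c x∈ y∈ (λ { (p , q , r) → o (p , r , q) })
  ... | _ , k | inj₁ refl = turned₂ k
  ... | _ , k | inj₂ refl = preceded₂ (flip ◅ ε) (turned₂ (corner-swap k))
  origin-represented₂ (new₃ x∈ y∈ x≢y) o = let _ , k = complete-corner {Γ} {f} x∈ y∈ x≢y in
    entered₂ k (touches-c x∈ y∈ o)

  refinement₂ : Refinement Γ f
  refinement₂ = record
    { Γ* = Γ₂
    ; shredding = step tetrahedron tetrahedron-sphere
        (step tetrahedron tetrahedron-sphere none S₁.isSum) S₂.isSum
    ; embed = L
    ; outer-step = lift-step₂
    -- Two stages: first out of `f₁` in the first subdivision, then out of `f`.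
    ; represented = λ φ → let _ , ψ , o , p = cone-represented Γ₁ f₁ φ in
        preceded₂ p (origin-represented₂ (S₁.origin ψ) o)
    }

  open Refinement refinement₂

  -- Inside f₁ the zigzag passes from q p to d p; it then leaves f through p c.
  cross₂ : ∀ {p q} → Corner Γ f p q c → Corner Γ₁ f₁ (ℓ q) (ℓ p) d → Joined q p p c
  cross₂ {p} {q} k k₁ {w} P Q =
    same-head⇒joined Γ₁ f₁ k₁
      (port (port-lift Γ f P) (lifted-outer {q , p , w} (port-lift Γ f P)))
      (port (cone-flag Γ f k') (c-outer (d , ℓ p , ℓ c) thd∈)) ◅◅
    fwd (step-rev (enter₂ (corner-swap k') Q (inj₁ refl))) ◅ ε
    where
    k' : Corner Γ f p c q
    k' = corner-rev (corner-rot k)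

  -- With `e` the apex of the second subdivision, the zigzag runs along `bc`, `cd`, `da`, `ae`,
  -- `eb`, `bd`, `dc`, `ca`.
  around₂ : Joined c b c a
  around₂ P Q =
    flip ◅ fwd (enter₂ (corner-rot C) P (inj₂ refl)) ◅ fwd (turn₂ (corner-rot C)) ◅ flip ◅
    (same-head⇒joined Γ₁ f₁ (corner-swap C₁) (spoke-port k) (spoke-port (corner-rot C)) ◅◅
    fwd (step-rev (turn₂ k)) ◅ fwd (step-rev (enter₂ k Q (inj₂ refl))) ◅ ε)
    where
    k : Corner Γ f a c b
    k = corner-rev (corner-rot C)

    spoke-port : ∀ {x z} → Corner Γ f x c z → Port Γ₁ f₁ (ℓ x) d (ℓ c)
    spoke-port {x} k = port (flag₂₁₃ (cone-flag Γ f k)) (c-outer (ℓ x , d , ℓ c) thd∈)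

  -- The two links and the three joins of the patch alternate in the chain `bc`, `ab`, `ac`, `ba`,
  -- `ca`, `cb`, which contains all six directed edges.
  merging₂ : Linked Γ f a b a c → Linked Γ f b a c a → Merging Γ f
  merging₂ l l' = joined⇒merging refinement₂ C ab~ba ab~ac ab~ca ab~bc
      (joined-trans (corner-rot (corner-rot C)) ab~ca (joined-sym around₂))
    where
    ab~ac : Joined a b a c
    ab~ac = linked⇒joined l
    ab~bc : Joined a b b c
    ab~bc = cross₂ (corner-swap C) (corner-rot C₁)
    ab~ba : Joined a b b a
    ab~ba = joined-trans (corner-rev (corner-rot C)) ab~ac
              (joined-sym (cross₂ C (corner-rev C₁)))
    ab~ca : Joined a b c a
    ab~ca = joined-trans (corner-swap C) ab~ba (linked⇒joined l')

module _ {Γ : Triangulation} {f : Face Γ} {a b c : Fin (nV Γ)} (C : Corner Γ f a b c) where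

  open Refinement (cone-refinement Γ f)

  -- As the cone joins equal heads, the hypothesis puts `ab`, `ac`, `bc`, `cb` in one group and
  -- leaves `ba`, `ca` in another; `h` bridges the two.
  merging₁ : Joined a b a c → (Joined a b b c → Joined a b c b → Joined a b b a) → Merging Γ f
  merging₁ ab~ac h = joined⇒merging (cone-refinement Γ f) C ab~ba ab~ac
      (joined-trans (corner-swap C) ab~ba (same-head⇒joined Γ f (corner-swap C))) ab~bc ab~cb
    where
    ab~bc : Joined a b b c
    ab~bc = joined-trans (corner-rev (corner-rot C)) ab~ac (same-head⇒joined Γ f (corner-rev (corner-rot C)))
    ab~cb : Joined a b c b
    ab~cb = same-head⇒joined Γ f C
    ab~ba : Joined a b b a
    ab~ba = h ab~bc ab~cb

  -- The split is on the partner of `ba`. Every partner but `ca` lies in the group of `ab`; for `ca`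
  -- the second subdivision is used.
  self-linked⇒merging : Linked Γ f a b a c → Merging Γ f
  self-linked⇒merging l with linking (corner-swap C)
  ... | to-xz m = merging₁ (linked⇒joined l) λ ab~bc _ →
          joined-trans (corner-rot C) ab~bc (joined-sym (linked⇒joined m))
  ... | to-yx m = merging₁ (linked⇒joined l) λ _ _ → joined-sym (linked⇒joined m)
  ... | to-yz m = merging₁ (linked⇒joined l) λ _ _ →
          joined-trans (corner-rev (corner-rot C)) (linked⇒joined l) (joined-sym (linked⇒joined m))
  ... | to-zx m = merging₁ (linked⇒joined l) λ _ ab~cb →
          joined-trans (corner-rev C) ab~cb (joined-sym (linked⇒joined m))
  ... | to-zy m = merging₂ C l m

-- Descent on the number of classes

initial-cover : ∀ Γ → Cover Γ (nV Γ ℕ.* (nV Γ ℕ.* nV Γ))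
initial-cover Γ = record
  { rep = decode
  ; class = λ {s} _ → encode {Γ} s
  ; same = λ {s} _ → subst (λ t → Equivalent Γ t s) (sym (decode-encode s)) ε
  }
  where
  N = nV Γ
  decode : Fin (N ℕ.* (N ℕ.* N)) → Tri N
  decode k = let x , yz = Fin.remQuot (N ℕ.* N) k in x , Fin.remQuot N yz

  decode-encode : ∀ s → decode (encode {Γ} s) ≡ s
  decode-encode (x , y , z) = trans
    (cong (λ p → proj₁ p , Fin.remQuot N (proj₂ p)) (Finₚ.remQuot-combine x (Fin.combine y z)))
    (cong (x ,_) (Finₚ.remQuot-combine y z))

face-flag : ∀ Γ i → Flag Γ (face Γ i)
face-flag Γ i = flag (proper Γ i) i ⊆T-refl

some-face : ∀ Γ → Face Γ
some-face Γ = Fin.fromℕ< (nonempty Γ)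

module _ {Γ : Triangulation} {m : ℕ} (C : Cover Γ m) where
  open Cover C

  -- Comparing rotations is enough, since a flag and its reversal are equivalent by `flip` whatever
  -- their labels.
  Monochromatic : Face Γ → Set
  Monochromatic i = class φ ≡ class (flag-rot φ) × class φ ≡ class (flag-rot (flag-rot φ))
    where φ = face-flag Γ i

  monochromatic? : ∀ i → Dec (Monochromatic i)
  monochromatic? i = (_ Fin.≟ _) ×-dec (_ Fin.≟ _)

  class-≡⇒~ : ∀ {s t} (φ : Flag Γ s) (ψ : Flag Γ t) → class φ ≡ class ψ → Equivalent Γ s t
  class-≡⇒~ φ ψ e = ~-sym (same φ) ◅◅ subst (λ k → Equivalent Γ (rep k) _) (sym e) (same ψ)

  monochromatic⇒zKnotted : (∀ i → Monochromatic i) → ZKnotted Γ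
  monochromatic⇒zKnotted mono = all-equivalent⇒zKnotted (_ , φ₀) λ t ψ →
    uniform⇒all-equivalent (λ i → rotations⇒uniform (corner (proper Γ i) ⊆T-refl)
      (class-≡⇒~ (face-flag Γ i) (flag-rot (face-flag Γ i)) (proj₁ (mono i)))
      (class-≡⇒~ (face-flag Γ i) (flag-rot (flag-rot (face-flag Γ i))) (proj₂ (mono i)))) φ₀ ψ
    where
    φ₀ = face-flag Γ (some-face Γ)

  bichromatic : ∀ {i} → ¬ Monochromatic i →
    ∃[ s ] ∃[ t ] Σ (Flag Γ s) λ φ → Σ (Flag Γ t) λ ψ →
      s ⊆T face Γ i × t ⊆T face Γ i × class φ ≢ class ψ
  bichromatic {i} n with class (face-flag Γ i) Fin.≟ class (flag-rot (face-flag Γ i))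
  ... | no ne = _ , _ , face-flag Γ i , flag-rot (face-flag Γ i) , ⊆T-refl , ⊆T-rot ⊆T-refl , ne
  ... | yes e = _ , _ , face-flag Γ i , flag-rot (flag-rot (face-flag Γ i)) , ⊆T-refl , ⊆T-rot (⊆T-rot ⊆T-refl) , λ e' → n (e , e')

-- Induction on the number of labels: a face with two labels either meets a single class already or
-- is refined, and in both cases a label is lost.
zKnotted-shredding : ∀ m Γ → Cover Γ m → ∃[ Γ' ] (Shredding Γ Γ' × ZKnotted Γ')
zKnotted-shredding zero Γ C with Cover.class C (face-flag Γ (some-face Γ))
... | ()
zKnotted-shredding (suc m) Γ C with Finₚ.all? (monochromatic? C)
... | yes mono = Γ , none , monochromatic⇒zKnotted C mono
... | no ¬mono with Finₚ.¬∀⟶∃¬ _ _ (monochromatic? C) ¬mono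
...   | i , n with bichromatic C n
...     | s , t , φ , ψ , s⊆ , t⊆ , ne with self-linked-or-uniform {Γ} {i}
-- The cover has two labels for a single class; one of them is dropped and `Γ` stays as it is.
...       | inj₂ uniform = zKnotted-shredding m Γ
              (identify-classes C φ ψ ne (uniform s t (Flag.distinct φ) s⊆ (Flag.distinct ψ) t⊆))
...       | inj₁ (_ , _ , _ , c , l) =
              let M = self-linked⇒merging c l
                  Γ' , sh , k = zKnotted-shredding m (Merging.Γ* M) (merged-cover M C φ ψ s⊆ t⊆ ne)
              in Γ' , shredding-trans (Merging.shredding M) sh , k

theorem1 : (Γ : Triangulation) → ∃[ Γ' ] (Shredding Γ Γ' × ZKnotted Γ')
theorem1 Γ = zKnotted-shredding _ Γ (initial-cover Γ)
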